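{- (1) For every positive divisor $\delta$ of $\lambda(2)$: $\displaystyle\sum_{\substack{a\in U_2\\ \mathrm{ind}_2(a)=\delta}} a\equiv 1\pmod 2$. (2) For every positive divisor $\delta$ of $\lambda(4)$: $\displaystyle\sum_{\substack{a\in U_4\\ \mathrm{ind}_4(a)=\delta}} a\equiv (-1)^{\delta+1}\pmod 4$. (3) For every positive divisor $\delta$ of $\lambda(8)$: $\displaystyle\sum_{\substack{a\in U_8\\ \mathrm{ind}_8(a)=\delta}} a\equiv (-1)^{\delta+1}\pmod 8$. (4) If $\alpha>3$ is an integer and $\delta=2^{\beta}$ with $1<\beta\le\alpha-2$, then $\displaystyle\sum_{\substack{a\in U_{2^\alpha}\\ \mathrm{ind}_{2^\alpha}(a)=\delta}} a\equiv 0\pmod{2^{\alpha}}$. (5) Let $p$ be an odd prime, $\alpha$ a positive integer and $\delta$ a positive divisor of $\lambda(p^\alpha)$. Then $$\sum_{\substack{a\in U_{p^{\alpha}}\\ \mathrm{ind}_{p^{\alpha}}(a)=\delta}} a\equiv \mu\big((\delta,p-1)\big)\,\phi\big(p^{\mathrm{ord}_p(\delta)}\big)\pmod{p^{\alpha}}.$$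
   Context: $U_m$ denotes the set of invertible elements of $\mathbb{Z}/m\mathbb{Z}$. For $a\in U_m$, $\mathrm{ind}_m(a)$ is the smallest positive integer $k$ with $a^k\equiv 1\pmod m$ (the multiplicative order of $a$). $\lambda(m)$ is the Carmichael function: the least $k>0$ such that $a^k\equiv1\pmod m$ for all $a\in U_m$. $\mu$ is the Möbius function, $\phi$ Euler's totient function, $(x,y)$ the gcd, and $\mathrm{ord}_p(n)=\max\{k: p^k\mid n\}$. -}

module Defs where

open import Data.Nat as ℕ using (ℕ; zero; suc; _<_; _≤_; s≤s; z≤n; _^_)
open import Data.Nat.Properties as ℕP using ()
open import Data.Nat.GCD using (gcd)
open import Data.Nat.Primality using (Prime; prime?)
import Data.Nat.Divisibility as ℕD
open import Data.Integer as ℤ using (ℤ; +_; -_; _-_)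
open import Data.Integer.Divisibility as ℤD using ()
open import Data.List using (List; filter; length; map; upTo)
open import Data.Nat.ListAction using (sum)
open import Data.Product using (_×_; _,_)
open import Relation.Binary.PropositionalEquality using (_≡_; refl)
open import Relation.Nullary using (¬_; Dec; yes; no)
open import Relation.Nullary.Decidable using (_×-dec_; ¬?)
open import Relation.Unary using (Pred; Decidable)

infix 4 _≡_[mod_]
_≡_[mod_] : ℤ → ℤ → ℕ → Set
x ≡ y [mod m ] = (+ m) ℤD.∣ (x - y)

_≡?_[mod_] : (x y : ℤ) (m : ℕ) → Dec (x ≡ y [mod m ])
x ≡? y [mod m ] = m ℕD.∣? ℤ.∣ x - y ∣

allBelow? : ∀ {P : Pred ℕ Agda.Primitive.lzero} → Decidable P → ∀ k → Dec (∀ j → j < k → P j)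
allBelow? P? zero = yes λ j ()
allBelow? {P} P? (suc k) with allBelow? P? k | P? k
... | no ¬all | _ = no λ h → ¬all λ j j<k → h j (ℕP.m≤n⇒m≤1+n j<k)
... | yes all | no ¬Pk = no λ h → ¬Pk (h k ℕP.≤-refl)
... | yes all | yes Pk = yes λ j j<1+k → help j (ℕP.m<1+n⇒m<n∨m≡n j<1+k)
  where
  open import Data.Sum using (inj₁; inj₂)
  help : ∀ j → _ → P j
  help j (inj₁ j<k) = all j j<k
  help j (inj₂ refl) = Pk

InU : ℕ → ℕ → Set
InU m a = gcd a m ≡ 1

PowIsOne : ℕ → ℕ → ℕ → Set
PowIsOne m a k = + (a ^ k) ≡ + 1 [mod m ]

IsInd : ℕ → ℕ → ℕ → Set
IsInd m a δ = 0 < δ × PowIsOne m a δ × (∀ j → j < δ → 0 < j → ¬ PowIsOne m a j)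

isInd? : ∀ m a δ → Dec (IsInd m a δ)
isInd? m a δ =
  (0 ℕ.<? δ) ×-dec ((+ (a ^ δ)) ≡? + 1 [mod m ]) ×-dec
  allBelow? (λ j → dec j) δ
  where
  dec : ∀ j → Dec (0 < j → ¬ PowIsOne m a j)
  dec j with 0 ℕ.<? j | (+ (a ^ j)) ≡? + 1 [mod m ]
  ... | no ¬p | _ = yes λ p → λ _ → ¬p p
  ... | yes p | yes q = no λ h → h p q
  ... | yes p | no ¬q = yes λ _ → ¬q

AllPowIsOne : ℕ → ℕ → Set
AllPowIsOne m k = ∀ a → a < m → InU m a → PowIsOne m a k

IsCarmichael : ℕ → ℕ → Set
IsCarmichael m L = 0 < L × AllPowIsOne m L × (∀ j → j < L → 0 < j → ¬ AllPowIsOne m j)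

indSum : ℕ → ℕ → ℕ
indSum m δ = sum (filter (λ a → (gcd a m ℕ.≟ 1) ×-dec isInd? m a δ) (upTo m))

-- Euler's totient  φ(n) = #{ a : 0 ≤ a < n, (a,n) = 1 }   (so φ(1) = 1)

φ : ℕ → ℕ
φ n = length (filter (λ a → gcd a n ℕ.≟ 1) (upTo n))

SquareFree : ℕ → Set
SquareFree n = ∀ p → p < suc n → Prime p → ¬ (p ℕ.* p ℕD.∣ n)

squareFree? : ∀ n → Dec (SquareFree n)
squareFree? n = allBelow? dec (suc n)
  where
  dec : ∀ p → Dec (Prime p → ¬ (p ℕ.* p ℕD.∣ n))
  dec p with prime? p | (p ℕ.* p) ℕD.∣? n
  ... | no ¬pr | _ = yes λ pr → λ _ → ¬pr pr
  ... | yes pr | yes d = no λ h → h pr d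
  ... | yes pr | no ¬d = yes λ _ → ¬d

ω : ℕ → ℕ
ω n = length (filter (λ p → prime? p ×-dec p ℕD.∣? n) (upTo (suc n)))

μ : ℕ → ℤ
μ n with squareFree? n
... | yes _ = (- (+ 1)) ℤ.^ ω n
... | no _ = + 0

{-# OPTIONS --safe #-}
module Submission where

-- For d ∣ λ(p^α), p odd, let G(d) be the sum of the solutions of x^d ≡ 1 modulo p^α. If d is not a
-- power of p, some solution u has u ≢ 1 modulo p: otherwise (λ(p^α)/d) p^(α-1) would be an exponent of
-- the unit group, hence a multiple of λ(p^α). Multiplication by u permutes the solutions, so
-- (u - 1) G(d) ≡ 0 and G(d) ≡ 0. If d = p^j, lifting the exponent shows that the solutions are the
-- x ≡ 1 modulo p^(α-j), whence G(p^j) ≡ p^j. The sum over the elements of order δ is the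
-- alternating sum of G(δ/e) over the squarefree e ∣ δ, in which only the powers of p survive: they
-- occur iff the part of δ prime to p, which is (δ, p - 1), is squarefree.
--
-- For p = 2 and δ = 2^β with β > 1, the elements of order δ are stable under x ↦ -x and x ↦ x + 2^(α-1).

open import Defs
open import Data.Nat as ℕ using (ℕ; zero; suc; _<_; _≤_; _∸_; _^_; _%_; s≤s; z≤n; NonZero)
import Data.Nat.Properties as ℕP
open import Data.Nat.Coprimality as Coprimality using (Coprime; coprime-divisor; gcd≡1⇒coprime; coprime⇒gcd≡1)
open import Data.Nat.Divisibility using (_∣_; _∤_; divides)
import Data.Nat.Divisibility as ∣ℕ
import Data.Nat.DivMod as DM
open import Data.Nat.GCD as GCD using (gcd)
open import Data.Nat.ListAction using (sum; product)
open import Data.Nat.ListAction.Properties using (sum-++; sum-↭; product-↭; ∈⇒∣product)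
open import Data.Nat.Primality using (Prime; prime?; euclidsLemma; prime⇒irreducible; prime⇒nonZero; prime⇒nonTrivial; ¬prime[1]; prime[2])
open import Data.Nat.Primality.Factorisation using (factorise)
import Data.Nat.Tactic.RingSolver as ℕS
open import Data.Integer as ℤ using (ℤ; +_; -_)
import Data.Integer.Properties as ℤP
import Data.Integer.Divisibility.Signed as ℤS
open import Data.Integer.Tactic.RingSolver using (solve-∀)
open import Data.List using (List; []; _∷_; _++_; filter; length; map; upTo; applyUpTo)
import Data.List.Properties as LP
open import Data.List.Membership.Propositional using (_∈_)
import Data.List.Membership.Propositional.Properties as MP
open import Data.List.Relation.Binary.Permutation.Propositional as Perm using (_↭_)
import Data.List.Relation.Binary.Permutation.Propositional.Properties as PermP
open import Data.List.Relation.Unary.All as All using (All; []; _∷_)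
import Data.List.Relation.Unary.All.Properties as AllP
open import Data.List.Relation.Unary.AllPairs using ([]; _∷_)
open import Data.List.Relation.Unary.Any using (here; there)
open import Data.List.Relation.Unary.Unique.Propositional using (Unique)
import Data.List.Relation.Unary.Unique.Propositional.Properties as UP
open import Data.Product using (_×_; _,_; proj₁; proj₂; ∃; Σ-syntax)
open import Data.Sum using (_⊎_; inj₁; inj₂)
open import Function using (_∘_; id; it)
open import Level using (0ℓ)
open import Relation.Binary.Bundles using (Setoid)
open import Relation.Binary.PropositionalEquality using (_≡_; _≢_; refl; sym; trans; cong; cong₂; subst; subst₂; module ≡-Reasoning)
import Relation.Binary.Reasoning.Setoid as SetoidReasoning
open import Relation.Nullary using (¬_; Dec; yes; no; contradiction)
open import Relation.Nullary.Decidable using (_×-dec_; _→-dec_; ¬?; from-yes)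
open import Relation.Unary using (Pred; Decidable)
open import Algebra.Properties.AbelianGroup ℤP.+-0-abelianGroup using () renaming (∙-cancelˡ to ℤ+-cancelˡ)

-- The alternating sum is never written over the divisors e. `Exact c qs` keeps the primes still to
-- be excluded in the list `qs`, and taking one prime `q` out of the list yields a difference of two
-- sums with the shorter list, for the cofactors `c * q` and `c`. Induction on the list evaluates
-- both: a prime other than p that has entered the cofactor stays there down to every leaf, so that
-- whole subtree vanishes; the branches that survive leave all such primes out, at the cost of one
-- sign for each.
--
-- λ(p^α) is given only by minimality. Bézout turns this into "λ divides every exponent of the unit
-- group", and Euler's theorem then gives λ(p^α) ∣ p^(α-1) (p-1). From this come both (δ, p-1) and
-- the bound j ≤ α-1.
--
-- At p = 2 the number p(p-1)/2 is not divisible by p, so the descent from y^p to y and the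
-- evaluation of G(p^j) both break down; hence the separate argument by symmetry.

infix 4 _∼[_]_

-- A record, so that its endpoints can be inferred, unlike those of _≡_[mod_].
record _∼[_]_ (x : ℤ) (m : ℕ) (y : ℤ) : Set where
  constructor multiple
  field
    quotient : ℤ
    equality : x ≡ y ℤ.+ quotient ℤ.* + m

-- Arithmetic of congruences

module _ {m : ℕ} where

  ∼⇒mod : ∀ {x y} → x ∼[ m ] y → x ≡ y [mod m ]
  ∼⇒mod {x} {y} (multiple k refl) = ℤS.∣⇒∣ᵤ (ℤS.divides k (eq y (k ℤ.* + m)))
    where
    eq : ∀ a b → (a ℤ.+ b) ℤ.- a ≡ b
    eq = solve-∀

  mod⇒∼ : ∀ {x y} → x ≡ y [mod m ] → x ∼[ m ] y
  mod⇒∼ {x} {y} d = multiple k (trans (eq x y) (cong (λ z → y ℤ.+ z) e))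
    where
    open ℤS._∣_ (ℤS.∣ᵤ⇒∣ {+ m} {x ℤ.- y} d) renaming (quotient to k; equality to e)
    eq : ∀ a b → a ≡ b ℤ.+ (a ℤ.- b)
    eq = solve-∀

  ∼-refl : ∀ {x} → x ∼[ m ] x
  ∼-refl {x} = multiple (+ 0) (eq x (+ m))
    where
    eq : ∀ x m → x ≡ x ℤ.+ + 0 ℤ.* m
    eq = solve-∀

  ∼-reflexive : ∀ {x y} → x ≡ y → x ∼[ m ] y
  ∼-reflexive refl = ∼-refl

  ∼-sym : ∀ {x y} → x ∼[ m ] y → y ∼[ m ] x
  ∼-sym {x} {y} (multiple k refl) = multiple (- k) (eq y k (+ m))
    where
    eq : ∀ y k m → y ≡ (y ℤ.+ k ℤ.* m) ℤ.+ (- k) ℤ.* m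
    eq = solve-∀

  ∼-trans : ∀ {x y z} → x ∼[ m ] y → y ∼[ m ] z → x ∼[ m ] z
  ∼-trans {z = z} (multiple k refl) (multiple l refl) = multiple (l ℤ.+ k) (eq z k l (+ m))
    where
    eq : ∀ z k l m → z ℤ.+ l ℤ.* m ℤ.+ k ℤ.* m ≡ z ℤ.+ (l ℤ.+ k) ℤ.* m
    eq = solve-∀

  ∼-+ : ∀ {x x′ y y′} → x ∼[ m ] x′ → y ∼[ m ] y′ → x ℤ.+ y ∼[ m ] x′ ℤ.+ y′
  ∼-+ {x′ = a} {y′ = b} (multiple k refl) (multiple l refl) = multiple (k ℤ.+ l) (eq a b k l (+ m))
    where
    eq : ∀ a b k l m → (a ℤ.+ k ℤ.* m) ℤ.+ (b ℤ.+ l ℤ.* m) ≡ (a ℤ.+ b) ℤ.+ (k ℤ.+ l) ℤ.* m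
    eq = solve-∀

  ∼-- : ∀ {x x′ y y′} → x ∼[ m ] x′ → y ∼[ m ] y′ → x ℤ.- y ∼[ m ] x′ ℤ.- y′
  ∼-- {x′ = a} {y′ = b} (multiple k refl) (multiple l refl) = multiple (k ℤ.- l) (eq a b k l (+ m))
    where
    eq : ∀ a b k l m → (a ℤ.+ k ℤ.* m) ℤ.- (b ℤ.+ l ℤ.* m) ≡ (a ℤ.- b) ℤ.+ (k ℤ.- l) ℤ.* m
    eq = solve-∀

  ∼-* : ∀ {x x′ y y′} → x ∼[ m ] x′ → y ∼[ m ] y′ → x ℤ.* y ∼[ m ] x′ ℤ.* y′
  ∼-* {x′ = a} {y′ = b} (multiple k refl) (multiple l refl) =
    multiple (a ℤ.* l ℤ.+ k ℤ.* b ℤ.+ k ℤ.* l ℤ.* + m) (eq a b k l (+ m))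
    where
    eq : ∀ a b k l m → (a ℤ.+ k ℤ.* m) ℤ.* (b ℤ.+ l ℤ.* m)
       ≡ (a ℤ.* b) ℤ.+ (a ℤ.* l ℤ.+ k ℤ.* b ℤ.+ k ℤ.* l ℤ.* m) ℤ.* m
    eq = solve-∀

  ∼-pos-* : ∀ {a a′ b b′} → + a ∼[ m ] + a′ → + b ∼[ m ] + b′ → + (a ℕ.* b) ∼[ m ] + (a′ ℕ.* b′)
  ∼-pos-* {a} {a′} {b} {b′} p q =
    subst₂ _∼[ m ]_ (sym (ℤP.pos-* a b)) (sym (ℤP.pos-* a′ b′)) (∼-* p q)

  ∼-pos-+ : ∀ {a a′ b b′} → + a ∼[ m ] + a′ → + b ∼[ m ] + b′ → + (a ℕ.+ b) ∼[ m ] + (a′ ℕ.+ b′)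
  ∼-pos-+ = ∼-+

  ∼-pos-^ : ∀ {a b} n → + a ∼[ m ] + b → + (a ^ n) ∼[ m ] + (b ^ n)
  ∼-pos-^ zero    p = ∼-refl
  ∼-pos-^ (suc n) p = ∼-pos-* p (∼-pos-^ n p)

  ∼0⇒∣ : ∀ {a} → + a ∼[ m ] + 0 → m ∣ a
  ∼0⇒∣ {a} p = subst (m ∣_) (cong ℤ.∣_∣ (ℤP.+-identityʳ (+ a))) (∼⇒mod p)

  ∣⇒∼0 : ∀ {a} → m ∣ a → + a ∼[ m ] + 0
  ∣⇒∼0 (divides q refl) = multiple (+ q) (trans (ℤP.pos-* q m) (sym (ℤP.+-identityˡ _)))

  ∼-% : .{{_ : NonZero m}} → ∀ a → + (a % m) ∼[ m ] + a
  ∼-% a = ∼-sym (multiple (+ (a DM./ m))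
    (trans (cong +_ (DM.m≡m%n+[m/n]*n a m)) (cong (λ z → + (a % m) ℤ.+ z) (ℤP.pos-* (a DM./ m) m))))

  ∼⇒≡ : ∀ {a b} → a < m → b < m → + a ∼[ m ] + b → a ≡ b
  ∼⇒≡ {a} {b} a<m b<m p =
    ℤP.+-injective (ℤP.i-j≡0⇒i≡j (+ a) (+ b) (ℤP.∣i∣≡0⇒i≡0 (∣⇒≡0 (∼⇒mod p) small)))
    where
    ∣⇒≡0 : ∀ {n} → m ∣ n → n < m → n ≡ 0
    ∣⇒≡0 {zero}  _ _ = refl
    ∣⇒≡0 {suc n} d l = contradiction (∣ℕ.∣⇒≤ d) (ℕP.<⇒≱ l)
    small : ℤ.∣ + a ℤ.- + b ∣ < m
    small = ℕP.≤-<-trans (subst (ℕ._≤ a ℕ.⊔ b) (cong ℤ.∣_∣ (sym (ℤP.[+m]-[+n]≡m⊖n a b))) (ℤP.∣m⊝n∣≤m⊔n a b))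
                         (ℕP.⊔-lub a<m b<m)

  -- The multiplier is an integer because it will be u - 1, and later the factor `w` of y^p - 1.
  ∼-cancelˡ : ∀ {u x y} → Coprime m ℤ.∣ u ∣ → u ℤ.* x ∼[ m ] u ℤ.* y → x ∼[ m ] y
  ∼-cancelˡ {u} {x} {y} c p = mod⇒∼ (coprime-divisor c
    (subst (m ∣_) (trans (cong ℤ.∣_∣ (sym (eq u x y))) (ℤP.abs-* u (x ℤ.- y))) (∼⇒mod p)))
    where
    eq : ∀ u x y → u ℤ.* (x ℤ.- y) ≡ u ℤ.* x ℤ.- u ℤ.* y
    eq = solve-∀

  ∼-pos-cancelˡ : ∀ {u x y} → Coprime m u → + (u ℕ.* x) ∼[ m ] + (u ℕ.* y) → + x ∼[ m ] + y
  ∼-pos-cancelˡ {u} {x} {y} c p = ∼-cancelˡ {+ u} c (subst₂ _∼[ m ]_ (ℤP.pos-* u x) (ℤP.pos-* u y) p)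

  ∼-setoid : Setoid _ _
  ∼-setoid = record
    { Carrier = ℤ ; _≈_ = _∼[ m ]_
    ; isEquivalence = record { refl = ∼-refl ; sym = ∼-sym ; trans = ∼-trans } }

∼-divisor : ∀ {m n x y} → n ∣ m → x ∼[ m ] y → x ∼[ n ] y
∼-divisor {n = n} {y = y} (divides q refl) (multiple k refl) =
  multiple (k ℤ.* + q) (cong (λ z → y ℤ.+ z) (trans (cong (k ℤ.*_) (ℤP.pos-* q n)) (sym (ℤP.*-assoc k (+ q) (+ n)))))

-- Powers congruent to one

One : ℕ → ℕ → Set
One m x = + x ∼[ m ] + 1

PowIsOne⇒One : ∀ m x k → PowIsOne m x k → One m (x ^ k)
PowIsOne⇒One _ _ _ = mod⇒∼

One⇒PowIsOne : ∀ m x k → One m (x ^ k) → PowIsOne m x k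
One⇒PowIsOne _ _ _ = ∼⇒mod

one? : ∀ m x → Dec (One m x)
one? m x with (+ x) ≡? (+ 1) [mod m ]
... | yes p = yes (mod⇒∼ p)
... | no ¬p = no (¬p ∘ ∼⇒mod)

One-^ : ∀ {m x} k → One m x → One m (x ^ k)
One-^ {m} {x} k p = subst (λ z → + (x ^ k) ∼[ m ] + z) (ℕP.^-zeroˡ k) (∼-pos-^ k p)

One-∣ : ∀ {m x a b} → a ∣ b → One m (x ^ a) → One m (x ^ b)
One-∣ {m} {x} {a} (divides q refl) p =
  subst (One m) (trans (ℕP.^-*-assoc x a q) (cong (x ^_) (ℕP.*-comm a q))) (One-^ q p)

One-* : ∀ {m x y} → One m x → One m y → One m (x ℕ.* y)
One-* = ∼-pos-*

One-cancel : ∀ {m x y} → One m (x ℕ.* y) → One m y → One m x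
One-cancel {m} {x} {y} xy y1 = ∼-trans (∼-sym x*y∼x) xy
  where
  x*y∼x : + (x ℕ.* y) ∼[ m ] + x
  x*y∼x = subst (λ z → + (x ℕ.* y) ∼[ m ] + z) (ℕP.*-identityʳ x) (∼-pos-* (∼-refl {x = + x}) y1)

-- In ℕ, Bézout reads gcd + v b = u a (or the same with a and b exchanged), so x^gcd becomes ≡ 1
-- after multiplication by a power of x that is itself ≡ 1.
One-gcd : ∀ {m x} a b → One m (x ^ a) → One m (x ^ b) → One m (x ^ gcd a b)
One-gcd {m} {x} a b pa pb with GCD.Bézout.identity (GCD.gcd-GCD a b)
... | GCD.Bézout.+- u v eq = One-cancel
  (subst (One m) (trans (cong (x ^_) (sym eq)) (ℕP.^-distribˡ-+-* x (gcd a b) (v ℕ.* b))) (One-∣ (divides u refl) pa))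
  (One-∣ {x = x} (divides v refl) pb)
... | GCD.Bézout.-+ u v eq = One-cancel
  (subst (One m) (trans (cong (x ^_) (sym eq)) (ℕP.^-distribˡ-+-* x (gcd a b) (u ℕ.* a))) (One-∣ (divides v refl) pb))
  (One-∣ {x = x} (divides u refl) pa)

One⇒coprime : ∀ {m x} k → 0 < k → One m (x ^ k) → Coprime m x
One⇒coprime {m} {x} (suc k) _ p {d} (d∣m , d∣x) =
  ∣ℕ.∣1⇒≡1 (∼0⇒∣ (∼-trans (∼-sym (∼-divisor d∣m p)) (∣⇒∼0 (∣ℕ.∣m⇒∣m*n (x ^ k) d∣x))))

-- Lists of residues

module _ {A : Set} where

  -- The pigeonhole principle: each entry of `xs` uses up one entry of `ys`, and the length bound
  -- leaves none over.
  Unique-⊆⇒↭ : {xs ys : List A} → Unique xs → (∀ {x} → x ∈ xs → x ∈ ys) →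
               length ys ≤ length xs → xs ↭ ys
  Unique-⊆⇒↭ {[]}     {[]} _ _ _ = Perm.↭-refl
  Unique-⊆⇒↭ {x ∷ xs} (x∉xs ∷ xs!) xs⊆ys |ys|≤|xs| with MP.∈-∃++ (xs⊆ys (here refl))
  ... | as , bs , refl = Perm.↭-trans (Perm.prep x (Unique-⊆⇒↭ xs! xs⊆as++bs |as++bs|≤|xs|)) (Perm.↭-sym (PermP.shift x as bs))
    where
    xs⊆as++bs : ∀ {y} → y ∈ xs → y ∈ as ++ bs
    xs⊆as++bs y∈xs with MP.∈-++⁻ as (xs⊆ys (there y∈xs))
    ... | inj₁ y∈as         = MP.∈-++⁺ˡ y∈as
    ... | inj₂ (here refl)  = contradiction refl (All.lookup x∉xs y∈xs)
    ... | inj₂ (there y∈bs) = MP.∈-++⁺ʳ as y∈bs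
    |as++bs|≤|xs| : length (as ++ bs) ≤ length xs
    |as++bs|≤|xs| = ℕ.s≤s⁻¹ (subst (_≤ suc (length xs)) (PermP.↭-length (PermP.shift x as bs)) |ys|≤|xs|)

  Unique-map⁺ : {B : Set} {f : A → B} {xs : List A} →
                (∀ {x y} → x ∈ xs → y ∈ xs → f x ≡ f y → x ≡ y) → Unique xs → Unique (map f xs)
  Unique-map⁺ inj []          = []
  Unique-map⁺ inj (x∉xs ∷ xs!) =
    AllP.map⁺ (All.tabulate λ y∈xs fx≡fy → All.lookup x∉xs y∈xs (inj (here refl) (there y∈xs) fx≡fy))
    ∷ Unique-map⁺ (λ x∈ y∈ → inj (there x∈) (there y∈)) xs!

module _ {P : Pred ℕ 0ℓ} (P? : Decidable P) where

  select : ℕ → List ℕ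
  select m = filter P? (upTo m)

  ∈-select⁻ : ∀ {m x} → x ∈ select m → x < m × P x
  ∈-select⁻ {m} x∈ with MP.∈-filter⁻ P? {xs = upTo m} x∈
  ... | x∈upTo , px = MP.∈-upTo⁻ x∈upTo , px

  ∈-select⁺ : ∀ {m x} → x < m → P x → x ∈ select m
  ∈-select⁺ x<m px = MP.∈-filter⁺ P? (MP.∈-upTo⁺ x<m) px

  select-permutes : ∀ {m} (f : ℕ → ℕ) →
    (∀ {x} → x < m → P x → f x < m × P (f x)) →
    (∀ {x y} → x < m → y < m → P x → P y → f x ≡ f y → x ≡ y) →
    map f (select m) ↭ select m
  select-permutes {m} f closed inj = Unique-⊆⇒↭
    (Unique-map⁺ inj′ (UP.filter⁺ P? (UP.upTo⁺ m)))
    sub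
    (ℕP.≤-reflexive (sym (LP.length-map f (select m))))
    where
    inj′ : ∀ {x y} → x ∈ select m → y ∈ select m → f x ≡ f y → x ≡ y
    inj′ x∈ y∈ with ∈-select⁻ x∈ | ∈-select⁻ y∈
    ... | x<m , px | y<m , py = inj x<m y<m px py
    sub : ∀ {y} → y ∈ map f (select m) → y ∈ select m
    sub y∈ with MP.∈-map⁻ f y∈
    ... | x , x∈ , refl with ∈-select⁻ x∈
    ... | x<m , px with closed x<m px
    ... | fx<m , pfx = ∈-select⁺ fx<m pfx

  select-*-permutes : ∀ {m u} .{{_ : NonZero m}} → Coprime m u → (∀ {x} → P x → P (u ℕ.* x % m)) →
    map (λ x → u ℕ.* x % m) (select m) ↭ select m
  select-*-permutes {m} {u} c closed = select-permutes (λ x → u ℕ.* x % m)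
    (λ {x} _ px → DM.m%n<n (u ℕ.* x) m , closed px)
    (λ {x} {y} x<m y<m _ _ e → ∼⇒≡ x<m y<m (∼-pos-cancelˡ c
      (∼-trans (∼-sym (∼-% (u ℕ.* x))) (∼-trans (∼-reflexive (cong +_ e)) (∼-% (u ℕ.* y))))))

sum-map-*% : ∀ {m} u .{{_ : NonZero m}} xs →
  + sum (map (λ x → u ℕ.* x % m) xs) ∼[ m ] + (u ℕ.* sum xs)
sum-map-*% {m} u [] = ∼-reflexive (cong +_ (sym (ℕP.*-zeroʳ u)))
sum-map-*% {m} u (x ∷ xs) =
  ∼-trans (∼-pos-+ {a = u ℕ.* x % m} {b = sum (map (λ x → u ℕ.* x % m) xs)} (∼-% (u ℕ.* x)) (sum-map-*% u xs))
          (∼-reflexive (cong +_ (sym (ℕP.*-distribˡ-+ u x (sum xs)))))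

product-map-*% : ∀ {m} u .{{_ : NonZero m}} xs →
  + product (map (λ x → u ℕ.* x % m) xs) ∼[ m ] + (u ^ length xs ℕ.* product xs)
product-map-*% {m} u [] = ∼-refl
product-map-*% {m} u (x ∷ xs) =
  ∼-trans (∼-pos-* (∼-% (u ℕ.* x)) (product-map-*% u xs))
          (∼-reflexive (cong +_ (eq u x (u ^ length xs) (product xs))))
  where
  eq : ∀ u x a b → u ℕ.* x ℕ.* (a ℕ.* b) ≡ u ℕ.* a ℕ.* (x ℕ.* b)
  eq = ℕS.solve-∀

sum-filter-split : ∀ {P Q : Pred ℕ 0ℓ} (P? : Decidable P) (Q? : Decidable Q) → (∀ {x} → Q x → P x) → ∀ xs →
  sum (filter P? xs) ≡ sum (filter (λ x → P? x ×-dec ¬? (Q? x)) xs) ℕ.+ sum (filter Q? xs)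
sum-filter-split P? Q? Q⇒P [] = refl
sum-filter-split P? Q? Q⇒P (x ∷ xs) with sum-filter-split P? Q? Q⇒P xs | P? x | Q? x
... | ih | yes _ | yes _ = trans (cong (x ℕ.+_) ih)
  (eq x (sum (filter (λ x → P? x ×-dec ¬? (Q? x)) xs)) (sum (filter Q? xs)))
  where
  eq : ∀ x a b → x ℕ.+ (a ℕ.+ b) ≡ a ℕ.+ (x ℕ.+ b)
  eq = ℕS.solve-∀
... | ih | yes _ | no _  = trans (cong (x ℕ.+_) ih) (sym (ℕP.+-assoc x _ _))
... | ih | no ¬p | yes q = contradiction (Q⇒P q) ¬p
... | ih | no _  | no _  = ih

upTo-+ : ∀ a b → upTo (a ℕ.+ b) ≡ upTo a ++ map (a ℕ.+_) (upTo b)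
upTo-+ a b = trans (split id a) (cong (upTo a ++_) (sym (LP.map-upTo (a ℕ.+_) b)))
  where
  split : (f : ℕ → ℕ) → ∀ a → applyUpTo f (a ℕ.+ b) ≡ applyUpTo f a ++ applyUpTo (f ∘ (a ℕ.+_)) b
  split f zero    = refl
  split f (suc a) = cong (f 0 ∷_) (split (f ∘ suc) a)

filter-map : ∀ {A B : Set} {P : Pred B 0ℓ} {Q : Pred A 0ℓ} (P? : Decidable P) (Q? : Decidable Q) (f : A → B) →
  (∀ {x} → P (f x) → Q x) → (∀ {x} → Q x → P (f x)) →
  ∀ xs → filter P? (map f xs) ≡ map f (filter Q? xs)
filter-map P? Q? f P⇒Q Q⇒P [] = refl
filter-map P? Q? f P⇒Q Q⇒P (x ∷ xs) with P? (f x) | Q? x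
... | yes _ | yes _ = cong (f x ∷_) (filter-map P? Q? f P⇒Q Q⇒P xs)
... | yes p | no ¬q = contradiction (P⇒Q p) ¬q
... | no ¬p | yes q = contradiction (Q⇒P q) ¬p
... | no _  | no _  = filter-map P? Q? f P⇒Q Q⇒P xs

sum-map-+ : ∀ h xs → sum (map (h ℕ.+_) xs) ≡ length xs ℕ.* h ℕ.+ sum xs
sum-map-+ h [] = refl
sum-map-+ h (x ∷ xs) = trans (cong (h ℕ.+ x ℕ.+_) (sum-map-+ h xs)) (eq h x (length xs ℕ.* h) (sum xs))
  where
  eq : ∀ h x a b → h ℕ.+ x ℕ.+ (a ℕ.+ b) ≡ h ℕ.+ a ℕ.+ (x ℕ.+ b)
  eq = ℕS.solve-∀

module _ {P : Pred ℕ 0ℓ} (P? : Decidable P) {h : ℕ}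
         (shift : ∀ {x} → P x → P (h ℕ.+ x)) (unshift : ∀ {x} → P (h ℕ.+ x) → P x) where

  select-periodic : ∀ n → select P? (h ℕ.+ n) ≡ select P? h ++ map (h ℕ.+_) (select P? n)
  select-periodic n = begin
    filter P? (upTo (h ℕ.+ n))                                 ≡⟨ cong (filter P?) (upTo-+ h n) ⟩
    filter P? (upTo h ++ map (h ℕ.+_) (upTo n))                ≡⟨ LP.filter-++ P? (upTo h) _ ⟩
    filter P? (upTo h) ++ filter P? (map (h ℕ.+_) (upTo n))    ≡⟨ cong (filter P? (upTo h) ++_) (filter-map P? P? (h ℕ.+_) unshift shift (upTo n)) ⟩
    filter P? (upTo h) ++ map (h ℕ.+_) (filter P? (upTo n))    ∎
    where open ≡-Reasoning

  length-select-* : ∀ n → length (select P? (n ℕ.* h)) ≡ n ℕ.* length (select P? h)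
  length-select-* zero    = refl
  length-select-* (suc n) = begin
    length (select P? (h ℕ.+ n ℕ.* h))                                       ≡⟨ cong length (select-periodic (n ℕ.* h)) ⟩
    length (select P? h ++ map (h ℕ.+_) (select P? (n ℕ.* h)))               ≡⟨ LP.length-++ (select P? h) ⟩
    length (select P? h) ℕ.+ length (map (h ℕ.+_) (select P? (n ℕ.* h)))     ≡⟨ cong (length (select P? h) ℕ.+_) (trans (LP.length-map (h ℕ.+_) (select P? (n ℕ.* h))) (length-select-* n)) ⟩
    length (select P? h) ℕ.+ n ℕ.* length (select P? h)                      ∎
    where open ≡-Reasoning

  sum-select-+ : ∀ n → sum (select P? (h ℕ.+ n)) ≡ sum (select P? h) ℕ.+ (length (select P? n) ℕ.* h ℕ.+ sum (select P? n))
  sum-select-+ n = trans (cong sum (select-periodic n))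
    (trans (sum-++ (select P? h) _) (cong (sum (select P? h) ℕ.+_) (sum-map-+ h (select P? n))))

-- Coprimality, Euler's theorem and the Carmichael function

coprime-*ˡ : ∀ {m n k} → Coprime m n → Coprime k n → Coprime (m ℕ.* k) n
coprime-*ˡ m⊥n k⊥n (d∣mk , d∣n) =
  k⊥n (coprime-divisor (λ (e∣d , e∣m) → m⊥n (e∣m , ∣ℕ.∣-trans e∣d d∣n)) d∣mk , d∣n)

coprime-^ˡ : ∀ {m n} k → Coprime m n → Coprime (m ^ k) n
coprime-^ˡ zero    _   = Coprimality.1-coprimeTo _
coprime-^ˡ (suc k) m⊥n = coprime-*ˡ m⊥n (coprime-^ˡ k m⊥n)

∤⇒coprime : ∀ {p n} → Prime p → p ∤ n → Coprime p n
∤⇒coprime pp p∤n (d∣p , d∣n) with prime⇒irreducible pp d∣p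
... | inj₁ d≡1  = d≡1
... | inj₂ refl = contradiction d∣n p∤n

p∤1 : ∀ {p} → Prime p → p ∤ 1
p∤1 pp p∣1 with refl ← ∣ℕ.∣1⇒≡1 p∣1 = ¬prime[1] pp

coprime-p^⇒∤ : ∀ {p n} k → Prime p → Coprime (p ^ suc k) n → p ∤ n
coprime-p^⇒∤ {p} k pp c p∣n with refl ← c (∣ℕ.∣m⇒∣m*n (p ^ k) ∣ℕ.∣-refl , p∣n) = ¬prime[1] pp

prime∣^⇒∣ : ∀ {r n} k → Prime r → r ∣ n ^ k → r ∣ n
prime∣^⇒∣ zero    rr r∣1 = contradiction r∣1 (p∤1 rr)
prime∣^⇒∣ {n = n} (suc k) rr r∣ with euclidsLemma n (n ^ k) rr r∣
... | inj₁ r∣n  = r∣n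
... | inj₂ r∣n^k = prime∣^⇒∣ k rr r∣n^k

prime∣prime⇒≡ : ∀ {r p} → Prime r → Prime p → r ∣ p → r ≡ p
prime∣prime⇒≡ rr pp r∣p with prime⇒irreducible pp r∣p
... | inj₁ refl = contradiction rr ¬prime[1]
... | inj₂ r≡p  = r≡p

prime-divisor : ∀ {n} .{{_ : NonZero n}} → n ≢ 1 → Σ[ r ∈ ℕ ] Prime r × r ∣ n
prime-divisor {n} n≢1 with factorise n
... | record { factors = [] ; isFactorisation = e } = contradiction e n≢1
... | record { factors = r ∷ rs ; isFactorisation = e ; factorsPrime = rr ∷ _ } =
  r , rr , subst (r ∣_) (sym e) (∣ℕ.∣m⇒∣m*n (product rs) ∣ℕ.∣-refl)

InU⇒coprime : ∀ {m a} → InU m a → Coprime m a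
InU⇒coprime = Coprimality.sym ∘ gcd≡1⇒coprime

coprime⇒InU : ∀ {m a} → Coprime m a → InU m a
coprime⇒InU = coprime⇒gcd≡1 ∘ Coprimality.sym

coprime-% : ∀ {m a} .{{_ : NonZero m}} → Coprime m a → Coprime m (a % m)
coprime-% {m} {a} c (d∣m , d∣a%m) =
  c (d∣m , ∣ℕ.∣n∣m%n⇒∣m d∣m d∣a%m)

coprime-product : ∀ {m} xs → All (Coprime m) xs → Coprime m (product xs)
coprime-product []       []       = Coprimality.sym (Coprimality.1-coprimeTo _)
coprime-product (x ∷ xs) (c ∷ cs) = Coprimality.sym (coprime-*ˡ (Coprimality.sym c) (Coprimality.sym (coprime-product xs cs)))

-- Multiplication by a permutes the units, so their product absorbs the factor a^φ(m); being a unit,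
-- it cancels.
euler : ∀ {m a} .{{_ : NonZero m}} → Coprime m a → One m (a ^ φ m)
euler {m} {a} c = ∼-pos-cancelˡ {u = product units} (coprime-product units (All.tabulate (InU⇒coprime ∘ proj₂ ∘ ∈-select⁻ U? {m})))
  (begin
    + (product units ℕ.* a ^ φ m)                 ≡⟨ cong +_ (ℕP.*-comm (product units) (a ^ φ m)) ⟩
    + (a ^ φ m ℕ.* product units)                 ≈⟨ product-map-*% a units ⟨
    + product (map (λ x → a ℕ.* x % m) units)     ≡⟨ cong +_ (product-↭ (select-*-permutes U? c
      λ {x} x∈U → coprime⇒InU (coprime-% (Coprimality.sym (coprime-*ˡ (Coprimality.sym c) (Coprimality.sym (InU⇒coprime x∈U))))))) ⟩
    + product units                               ≡⟨ cong +_ (ℕP.*-identityʳ (product units)) ⟨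
    + (product units ℕ.* 1)                       ∎)
  where
  open SetoidReasoning (∼-setoid {m})
  U? : Decidable (InU m)
  U? x = gcd x m ℕ.≟ 1
  units : List ℕ
  units = select U? m

-- By `One-gcd` the gcd of two exponents of the unit group is again an exponent, and minimality
-- forces gcd(L, n) = L.
carmichael-∣ : ∀ {m L n} → IsCarmichael m L → (∀ {a} → a < m → Coprime m a → One m (a ^ n)) → L ∣ n
carmichael-∣ {m} {L} {n} (0<L , all , minimal) all′ = subst (_∣ n) gcd≡L (GCD.gcd[m,n]∣n L n)
  where
  instance
    L≢0 : NonZero L
    L≢0 = ℕ.>-nonZero 0<L
  allgcd : AllPowIsOne m (gcd L n)
  allgcd a a<m a∈U = One⇒PowIsOne m a (gcd L n) (One-gcd L n (PowIsOne⇒One m a L (all a a<m a∈U)) (all′ a<m (InU⇒coprime a∈U)))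
  gcd≡L : gcd L n ≡ L
  gcd≡L with ℕP.m≤n⇒m<n∨m≡n (∣ℕ.∣⇒≤ (GCD.gcd[m,n]∣m L n))
  ... | inj₂ e = e
  ... | inj₁ g<L = contradiction allgcd (minimal (gcd L n) g<L (ℕP.n≢0⇒n>0 λ e → ℕP.<⇒≢ 0<L (sym (GCD.gcd[m,n]≡0⇒m≡0 e))))

-- Being prime to p^(k+1) means not being divisible by p, a condition of period p: there are p^k
-- periods, each missing only its multiple of p.
φ-prime-power : ∀ {p} k → Prime p → φ (p ^ suc k) ≡ p ^ k ℕ.* (p ∸ 1)
φ-prime-power {p} k pp = begin
  φ (p ^ suc k)                                      ≡⟨ cong length (LP.filter-≐ _ p∤? (p∤⇐ , p∤⇒) (upTo (p ^ suc k))) ⟩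
  length (select p∤? (p ℕ.* p ^ k))                  ≡⟨ cong (length ∘ select p∤?) (ℕP.*-comm p (p ^ k)) ⟩
  length (select p∤? (p ^ k ℕ.* p))                  ≡⟨ length-select-* p∤? (λ p∤x → p∤x ∘ λ p∣p+x → ∣ℕ.∣m+n∣m⇒∣n p∣p+x ∣ℕ.∣-refl) (λ p∤p+x → p∤p+x ∘ ∣ℕ.∣m∣n⇒∣m+n ∣ℕ.∣-refl) (p ^ k) ⟩
  p ^ k ℕ.* length (select p∤? p)                    ≡⟨ cong (p ^ k ℕ.*_) (count p ℕP.≤-refl) ⟩
  p ^ k ℕ.* (p ∸ 1)                                  ∎
  where
  open ≡-Reasoning
  p∤? : Decidable (p ∤_)
  p∤? x = ¬? (p ∣ℕ.∣? x)
  p∤⇐ : ∀ {x} → gcd x (p ^ suc k) ≡ 1 → p ∤ x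
  p∤⇐ = coprime-p^⇒∤ k pp ∘ InU⇒coprime
  p∤⇒ : ∀ {x} → p ∤ x → gcd x (p ^ suc k) ≡ 1
  p∤⇒ = coprime⇒InU ∘ coprime-^ˡ (suc k) ∘ ∤⇒coprime pp
  count : ∀ n → n ≤ p → length (select p∤? n) ≡ n ∸ 1
  count zero    _   = refl
  count (suc n) n<p = begin
    length (select p∤? (suc n))            ≡⟨ cong length (LP.filter-reject p∤? (λ p∤0 → p∤0 (p ∣ℕ.∣0))) ⟩
    length (filter p∤? (applyUpTo suc n))  ≡⟨ cong length (LP.filter-all p∤? (AllP.applyUpTo⁺₁ suc n λ i<n p∣ → ℕP.<⇒≱ (ℕP.≤-<-trans i<n n<p) (∣ℕ.∣⇒≤ p∣))) ⟩
    length (applyUpTo suc n)               ≡⟨ LP.length-applyUpTo suc n ⟩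
    n                                      ∎

-- Lifting the exponent

pos-^ : ∀ x n → + (x ^ n) ≡ (+ x) ℤ.^ n
pos-^ x zero    = refl
pos-^ x (suc n) = trans (ℤP.pos-* x (x ^ n)) (cong (+ x ℤ.*_) (pos-^ x n))

-- The binomial coefficient n(n-1)/2, that is 0 + 1 + ⋯ + (n-1).
triangle : ℕ → ℕ
triangle zero    = 0
triangle (suc n) = n ℕ.+ triangle n

2*triangle : ∀ n → triangle (suc n) ℕ.* 2 ≡ suc n ℕ.* n
2*triangle zero    = refl
2*triangle (suc n) = trans (eq n (triangle n)) (trans (cong (λ t → suc n ℕ.* 2 ℕ.+ t) (2*triangle n)) (eq′ n))
  where
  eq : ∀ n t → (suc n ℕ.+ (n ℕ.+ t)) ℕ.* 2 ≡ suc n ℕ.* 2 ℕ.+ (n ℕ.+ t) ℕ.* 2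
  eq = ℕS.solve-∀
  eq′ : ∀ n → suc n ℕ.* 2 ℕ.+ suc n ℕ.* n ≡ suc (suc n) ℕ.* suc n
  eq′ = ℕS.solve-∀

-- This is how oddness of p enters: in the linear term of the geometric sum for y^p - 1, and in the
-- sum of the residues 1 + i h for i < p^j.
odd∣triangle : ∀ n → Coprime n 2 → n ∣ triangle n
odd∣triangle zero    _    = divides 0 refl
odd∣triangle (suc n) n⊥2 = coprime-divisor n⊥2
  (divides n (trans (ℕP.*-comm 2 (triangle (suc n))) (trans (2*triangle n) (ℕP.*-comm (suc n) n))))

geometric : ℤ → ℕ → ℤ
geometric x zero    = + 0
geometric x (suc n) = + 1 ℤ.+ x ℤ.* geometric x n

^-1-factor : ∀ x n → x ℤ.^ n ≡ + 1 ℤ.+ (x ℤ.- + 1) ℤ.* geometric x n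
^-1-factor x zero    = eq x
  where
  eq : ∀ x → + 1 ≡ + 1 ℤ.+ (x ℤ.- + 1) ℤ.* + 0
  eq = solve-∀
^-1-factor x (suc n) = trans (cong (x ℤ.*_) (^-1-factor x n)) (eq x (geometric x n))
  where
  eq : ∀ x g → x ℤ.* (+ 1 ℤ.+ (x ℤ.- + 1) ℤ.* g) ≡ + 1 ℤ.+ (x ℤ.- + 1) ℤ.* (+ 1 ℤ.+ x ℤ.* g)
  eq = solve-∀

-- A second-order expansion in y: every use has p ∣ y, so only the existence of the remainder r
-- matters.
geometric-expansion : ∀ y n → ∃ λ r →
  geometric (+ 1 ℤ.+ y) n ≡ + n ℤ.+ y ℤ.* + triangle n ℤ.+ y ℤ.* y ℤ.* r
geometric-expansion y zero = + 0 , eq y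
  where
  eq : ∀ y → + 0 ≡ + 0 ℤ.+ y ℤ.* + 0 ℤ.+ y ℤ.* y ℤ.* + 0
  eq = solve-∀
geometric-expansion y (suc n) with geometric-expansion y n
... | r , e = r ℤ.+ + triangle n ℤ.+ y ℤ.* r ,
  trans (cong (λ g → + 1 ℤ.+ (+ 1 ℤ.+ y) ℤ.* g) e) (eq (+ n) y (+ triangle n) r)
  where
  eq : ∀ n y t r → + 1 ℤ.+ (+ 1 ℤ.+ y) ℤ.* (n ℤ.+ y ℤ.* t ℤ.+ y ℤ.* y ℤ.* r)
     ≡ (+ 1 ℤ.+ n) ℤ.+ y ℤ.* (n ℤ.+ t) ℤ.+ y ℤ.* y ℤ.* (r ℤ.+ t ℤ.+ y ℤ.* r)
  eq = solve-∀

^-suc-^ : ∀ x p j → x ^ (p ^ suc j) ≡ (x ^ (p ^ j)) ^ p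
^-suc-^ x p j = sym (trans (ℕP.^-*-assoc x (p ^ j) p) (cong (x ^_) (ℕP.*-comm (p ^ j) p)))

-- If y = k m + 1 and p ∣ m, then y^p - 1 = k m (y^(p-1) + ⋯ + 1), whose last factor is ≡ p ≡ 0 mod p.
One-^p : ∀ {p m y} → p ∣ m → One m y → One (p ℕ.* m) (y ^ p)
One-^p {p} {m} {y} (divides q refl) (multiple k e) with geometric-expansion (k ℤ.* + m) p
... | r , e′ = multiple (k ℤ.* s)
  (begin
    + (y ^ p)                                                       ≡⟨ pos-^ y p ⟩
    (+ y) ℤ.^ p                                                     ≡⟨ cong (ℤ._^ p) e ⟩
    (+ 1 ℤ.+ k ℤ.* + m) ℤ.^ p                                       ≡⟨ ^-1-factor (+ 1 ℤ.+ k ℤ.* + m) p ⟩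
    + 1 ℤ.+ (+ 1 ℤ.+ k ℤ.* + m ℤ.- + 1) ℤ.* geometric (+ 1 ℤ.+ k ℤ.* + m) p ≡⟨ cong (λ g → + 1 ℤ.+ (+ 1 ℤ.+ k ℤ.* + m ℤ.- + 1) ℤ.* g) (trans e′ geo) ⟩
    + 1 ℤ.+ (+ 1 ℤ.+ k ℤ.* + m ℤ.- + 1) ℤ.* (+ p ℤ.* s)             ≡⟨ eq k (+ m) (+ p) s ⟩
    + 1 ℤ.+ k ℤ.* s ℤ.* (+ p ℤ.* + m)                               ≡⟨ cong (λ z → + 1 ℤ.+ k ℤ.* s ℤ.* z) (sym (ℤP.pos-* p m)) ⟩
    + 1 ℤ.+ k ℤ.* s ℤ.* + (p ℕ.* m)                                 ∎)
  where
  open ≡-Reasoning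
  Q T s : ℤ
  Q = + q
  T = + triangle p
  s = + 1 ℤ.+ k ℤ.* Q ℤ.* T ℤ.+ k ℤ.* Q ℤ.* (k ℤ.* (Q ℤ.* + p)) ℤ.* r
  eq : ∀ k m p s → + 1 ℤ.+ (+ 1 ℤ.+ k ℤ.* m ℤ.- + 1) ℤ.* (p ℤ.* s) ≡ + 1 ℤ.+ k ℤ.* s ℤ.* (p ℤ.* m)
  eq = solve-∀
  eq′ : ∀ k q p t r → p ℤ.+ k ℤ.* (q ℤ.* p) ℤ.* t ℤ.+ k ℤ.* (q ℤ.* p) ℤ.* (k ℤ.* (q ℤ.* p)) ℤ.* r
      ≡ p ℤ.* (+ 1 ℤ.+ k ℤ.* q ℤ.* t ℤ.+ k ℤ.* q ℤ.* (k ℤ.* (q ℤ.* p)) ℤ.* r)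
  eq′ = solve-∀
  geo : + p ℤ.+ k ℤ.* + m ℤ.* T ℤ.+ k ℤ.* + m ℤ.* (k ℤ.* + m) ℤ.* r ≡ + p ℤ.* s
  geo = trans (cong (λ M → + p ℤ.+ k ℤ.* M ℤ.* T ℤ.+ k ℤ.* M ℤ.* (k ℤ.* M) ℤ.* r) (ℤP.pos-* q p)) (eq′ k Q (+ p) T r)

One-^p^ : ∀ {p e x} j → One (p ^ suc e) x → One (p ^ (j ℕ.+ suc e)) (x ^ (p ^ j))
One-^p^ {x = x} zero h = subst (One _) (sym (ℕP.*-identityʳ x)) h
One-^p^ {p} {e} {x} (suc j) h = subst (One _) (sym (^-suc-^ x p j))
  (One-^p (subst (λ n → p ∣ p ^ n) (sym (ℕP.+-suc j e)) (∣ℕ.∣m⇒∣m*n (p ^ (j ℕ.+ e)) ∣ℕ.∣-refl)) (One-^p^ j h))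

-- Conversely, if y = p z + 1 then y^p - 1 = p² z w with w ≡ 1 mod p, as p divides the triangular number of p.
One-^p⁻¹ : ∀ {p y} e → Prime p → Coprime p 2 → One p y → One (p ^ suc e) (y ^ p) → One (p ^ e) y
One-^p⁻¹ {p} {y} e pp p⊥2 (multiple z ey) (multiple l el) with geometric-expansion (z ℤ.* + p) p | odd∣triangle p p⊥2
... | r , er | divides t et = subst₂ _∼[ p ^ e ]_ (sym ey) refl (∼-+ (∼-refl {x = + 1})
        (∼-cancelˡ {u = w} (coprime-^ˡ e (∤⇒coprime pp p∤w)) (∼-trans wzp≡l (∼-reflexive (sym (ℤP.*-zeroʳ w))))))
  where
  instance
    p≢0 : NonZero p
    p≢0 = prime⇒nonZero pp
  T w : ℤ
  T = + t
  w = + 1 ℤ.+ (z ℤ.* T ℤ.+ z ℤ.* z ℤ.* r) ℤ.* + p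
  p∤w : p ∤ ℤ.∣ w ∣
  p∤w d = p∤1 pp (∼0⇒∣ (∼-trans (∼-sym (multiple (z ℤ.* T ℤ.+ z ℤ.* z ℤ.* r) refl)) (w∼0 d)))
    where
    w∼0 : p ∣ ℤ.∣ w ∣ → w ∼[ p ] + 0
    w∼0 d = mod⇒∼ (subst (p ∣_) (cong ℤ.∣_∣ (sym (ℤP.+-identityʳ w))) d)
  geo : geometric (+ 1 ℤ.+ z ℤ.* + p) p ≡ + p ℤ.* w
  geo = trans er (trans (cong (λ t → + p ℤ.+ z ℤ.* + p ℤ.* t ℤ.+ z ℤ.* + p ℤ.* (z ℤ.* + p) ℤ.* r) (trans (cong +_ et) (ℤP.pos-* t p))) (eq z (+ p) T r))
    where
    eq : ∀ z p t r → p ℤ.+ z ℤ.* p ℤ.* (t ℤ.* p) ℤ.+ z ℤ.* p ℤ.* (z ℤ.* p) ℤ.* r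
       ≡ p ℤ.* (+ 1 ℤ.+ (z ℤ.* t ℤ.+ z ℤ.* z ℤ.* r) ℤ.* p)
    eq = solve-∀
  y^p : + (y ^ p) ≡ + 1 ℤ.+ w ℤ.* (z ℤ.* + p) ℤ.* + p
  y^p = begin
    + (y ^ p)                            ≡⟨ pos-^ y p ⟩
    (+ y) ℤ.^ p                          ≡⟨ cong (ℤ._^ p) ey ⟩
    (+ 1 ℤ.+ z ℤ.* + p) ℤ.^ p            ≡⟨ ^-1-factor (+ 1 ℤ.+ z ℤ.* + p) p ⟩
    + 1 ℤ.+ (+ 1 ℤ.+ z ℤ.* + p ℤ.- + 1) ℤ.* geometric (+ 1 ℤ.+ z ℤ.* + p) p ≡⟨ cong (λ g → + 1 ℤ.+ (+ 1 ℤ.+ z ℤ.* + p ℤ.- + 1) ℤ.* g) geo ⟩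
    + 1 ℤ.+ (+ 1 ℤ.+ z ℤ.* + p ℤ.- + 1) ℤ.* (+ p ℤ.* w) ≡⟨ eq (z ℤ.* + p) (+ p) w ⟩
    + 1 ℤ.+ w ℤ.* (z ℤ.* + p) ℤ.* + p    ∎
    where
    open ≡-Reasoning
    eq : ∀ a p w → + 1 ℤ.+ (+ 1 ℤ.+ a ℤ.- + 1) ℤ.* (p ℤ.* w) ≡ + 1 ℤ.+ w ℤ.* a ℤ.* p
    eq = solve-∀
  -- Comparing y^p = 1 + w z p p with y^p = 1 + l p^(e+1) and cancelling one factor p; the unit w is
  -- removed afterwards, which leaves y - 1 = z p ≡ 0.
  wzp≡l : w ℤ.* (z ℤ.* + p) ∼[ p ^ e ] + 0
  wzp≡l = multiple l (trans (ℤP.*-cancelʳ-≡ (w ℤ.* (z ℤ.* + p)) (l ℤ.* + (p ^ e)) (+ p) {{nz}} (trans (ℤ+-cancelˡ (+ 1) (w ℤ.* (z ℤ.* + p) ℤ.* + p) (l ℤ.* + (p ^ suc e)) (trans (sym y^p) el)) l*p^)) (sym (ℤP.+-identityˡ _)))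
    where
    nz : ℤ.NonZero (+ p)
    nz = p≢0
    l*p^ : l ℤ.* + (p ^ suc e) ≡ l ℤ.* + (p ^ e) ℤ.* + p
    l*p^ = trans (cong (l ℤ.*_) (trans (ℤP.pos-* p (p ^ e)) (ℤP.*-comm (+ p) (+ (p ^ e))))) (sym (ℤP.*-assoc l (+ (p ^ e)) (+ p)))

One-^p^⁻¹ : ∀ {p x} e j → Prime p → Coprime p 2 → One p x → One (p ^ (j ℕ.+ e)) (x ^ (p ^ j)) → One (p ^ e) x
One-^p^⁻¹ {x = x} e zero    pp p⊥2 h h′ = subst (One _) (ℕP.*-identityʳ x) h′
One-^p^⁻¹ {p} {x} e (suc j) pp p⊥2 h h′ =
  One-^p^⁻¹ e j pp p⊥2 h (One-^p⁻¹ (j ℕ.+ e) pp p⊥2 (One-^ (p ^ j) h) (subst (One _) (^-suc-^ x p j) h′))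

-- Inclusion–exclusion over prime divisors of the order

-- The exponents n / r for r in qs, where n = c * product qs.
cofactors : ℕ → List ℕ → List ℕ
cofactors c []       = []
cofactors c (q ∷ qs) = c ℕ.* product qs ∷ cofactors (c ℕ.* q) qs

cofactors-scale : ∀ c q qs → cofactors (c ℕ.* q) qs ≡ map (ℕ._* q) (cofactors c qs)
cofactors-scale c q []       = refl
cofactors-scale c q (r ∷ qs) = cong₂ _∷_ (eq c q (product qs))
  (trans (cong (λ z → cofactors z qs) (eq c q r)) (cofactors-scale (c ℕ.* r) q qs))
  where
  eq : ∀ c q r → c ℕ.* q ℕ.* r ≡ c ℕ.* r ℕ.* q
  eq = ℕS.solve-∀

∈-cofactors⁻ : ∀ {s} c qs → s ∈ cofactors c qs → Σ[ r ∈ ℕ ] r ∈ qs × s ℕ.* r ≡ c ℕ.* product qs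
∈-cofactors⁻ c (q ∷ qs) (here refl) = q , here refl , trans (ℕP.*-assoc c (product qs) q) (cong (c ℕ.*_) (ℕP.*-comm (product qs) q))
∈-cofactors⁻ c (q ∷ qs) (there s∈) with ∈-cofactors⁻ (c ℕ.* q) qs s∈
... | r , r∈ , e = r , there r∈ , trans e (ℕP.*-assoc c q (product qs))

∈-cofactors⁺ : ∀ {s r} c qs → .{{_ : NonZero r}} → r ∈ qs → s ℕ.* r ≡ c ℕ.* product qs → s ∈ cofactors c qs
∈-cofactors⁺ {s} c (q ∷ qs) (here refl) e = here (ℕP.*-cancelʳ-≡ s (c ℕ.* product qs) q
  (trans e (trans (cong (c ℕ.*_) (ℕP.*-comm q (product qs))) (sym (ℕP.*-assoc c (product qs) q)))))
∈-cofactors⁺ c (q ∷ qs) (there r∈) e = there (∈-cofactors⁺ (c ℕ.* q) qs r∈ (trans e (sym (ℕP.*-assoc c q (product qs)))))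

gcd-*-coprime : ∀ s {q r} → Coprime q r → gcd (s ℕ.* q) (s ℕ.* r) ≡ s
gcd-*-coprime s {q} {r} c = trans (sym (GCD.c*gcd[m,n]≡gcd[cm,cn] s q r))
  (trans (cong (s ℕ.*_) (coprime⇒gcd≡1 c)) (ℕP.*-identityʳ s))

module _ (m : ℕ) where

  -- Interpolates between the two kinds of sum: for empty `qs` it is the equation x^c ≡ 1, and when
  -- `qs` lists all primes of n = c * product qs it says that x has order n.
  Exact : ℕ → List ℕ → ℕ → Set
  Exact c qs x = One m (x ^ (c ℕ.* product qs)) × All (λ s → ¬ One m (x ^ s)) (cofactors c qs)

  exact? : ∀ c qs → Decidable (Exact c qs)
  exact? c qs x = one? m (x ^ (c ℕ.* product qs)) ×-dec All.all? (λ s → ¬? (one? m (x ^ s))) (cofactors c qs)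

  exactSum : ℕ → List ℕ → ℕ
  exactSum c qs = sum (select (exact? c qs) m)

  -- Let s be a cofactor, so that s r = c * product qs for some r in `qs`. If x^(s q) ≡ 1, then x^(s
  -- r) ≡ 1 and the coprimality of q and r give x^s ≡ 1, which is excluded.
  Exact-scale : ∀ {c q qs x} → All (Coprime q) qs → Exact c qs x → Exact (c ℕ.* q) qs x
  Exact-scale {c} {q} {qs} {x} q⊥qs (one , none) =
    One-∣ {x = x} {a = c ℕ.* product qs} {b = c ℕ.* q ℕ.* product qs} (∣ℕ.*-monoˡ-∣ {c} {c ℕ.* q} (product qs) (∣ℕ.m∣m*n q)) one ,
    subst (All _) (sym (cofactors-scale c q qs)) (AllP.map⁺ (All.tabulate none′))
    where
    none′ : ∀ {s} → s ∈ cofactors c qs → ¬ One m (x ^ (s ℕ.* q))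
    none′ {s} s∈ one′ with ∈-cofactors⁻ c qs s∈
    ... | r , r∈ , e = All.lookup none s∈
      (subst (λ n → One m (x ^ n)) (gcd-*-coprime s (All.lookup q⊥qs r∈))
        (One-gcd (s ℕ.* q) (s ℕ.* r) one′ (subst (λ n → One m (x ^ n)) (sym e) one)))

  -- One step of inclusion-exclusion: the elements of `Exact (c * q) qs` are sorted by whether the
  -- exponent c * product qs already kills them. Those that it kills form `Exact c qs`.
  exactSum-∷ : ∀ {c q qs} → All (Coprime q) qs → exactSum (c ℕ.* q) qs ≡ exactSum c (q ∷ qs) ℕ.+ exactSum c qs
  exactSum-∷ {c} {q} {qs} q⊥qs = trans
    (sum-filter-split (exact? (c ℕ.* q) qs) (exact? c qs) (Exact-scale q⊥qs) (upTo m))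
    (cong (λ xs → sum xs ℕ.+ exactSum c qs)
      (LP.filter-≐ (λ x → exact? (c ℕ.* q) qs x ×-dec ¬? (exact? c qs x)) (exact? c (q ∷ qs)) (to , from) (upTo m)))
    where
    to : ∀ {x} → Exact (c ℕ.* q) qs x × ¬ Exact c qs x → Exact c (q ∷ qs) x
    to {x} ((one , none) , ¬exact) =
      subst (λ n → One m (x ^ n)) (ℕP.*-assoc c q (product qs)) one ,
      (λ one′ → ¬exact (one′ , All.map (λ {s} ¬one one″ → ¬one (One-∣ {x = x} {a = s} (∣ℕ.m∣m*n q) one″))
        (AllP.map⁻ (subst (All _) (cofactors-scale c q qs) none)))) ∷ none
    from : ∀ {x} → Exact c (q ∷ qs) x → Exact (c ℕ.* q) qs x × ¬ Exact c qs x
    from {x} (one , ¬one ∷ none) =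
      (subst (λ n → One m (x ^ n)) (sym (ℕP.*-assoc c q (product qs))) one , none) , ¬one ∘ proj₁

  exactSum-[] : ∀ c → exactSum c [] ≡ sum (select (λ x → one? m (x ^ c)) m)
  exactSum-[] c = cong sum (LP.filter-≐ (exact? c []) (λ x → one? m (x ^ c))
    ((λ {x} → subst (λ n → One m (x ^ n)) (ℕP.*-identityʳ c) ∘ proj₁) ,
     (λ {x} one → subst (λ n → One m (x ^ n)) (sym (ℕP.*-identityʳ c)) one , [])) (upTo m))

  module _ {c : ℕ} {qs : List ℕ} (0<δ : 0 < c ℕ.* product qs) (primes : All Prime qs)
           (complete : ∀ {r} → Prime r → r ∣ c ℕ.* product qs → r ∈ qs) where

    private
      δ : ℕ
      δ = c ℕ.* product qs
      instance
        δ≢0 : NonZero δ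
        δ≢0 = ℕ.>-nonZero 0<δ

    IsInd⇒Exact : ∀ {x} → IsInd m x δ → Exact c qs x
    IsInd⇒Exact {x} (_ , one , minimal) = PowIsOne⇒One m x δ one , All.tabulate none
      where
      none : ∀ {s} → s ∈ cofactors c qs → ¬ One m (x ^ s)
      none {s} s∈ with ∈-cofactors⁻ c qs s∈
      ... | r , r∈ , e = minimal s s<δ 0<s ∘ One⇒PowIsOne m x s
        where
        0<s : 0 < s
        0<s = ℕP.n≢0⇒n>0 λ { refl → ℕP.<⇒≢ 0<δ e }
        s<δ : s < δ
        s<δ = subst (s <_) e (ℕP.m<m*n s r {{ℕ.>-nonZero 0<s}} (ℕ.nonTrivial⇒n>1 r {{prime⇒nonTrivial (All.lookup primes r∈)}}))

    Exact⇒IsInd : ∀ {x} → Exact c qs x → IsInd m x δ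
    Exact⇒IsInd {x} (one , none) = 0<δ , One⇒PowIsOne m x δ one , minimal
      where
      t≢1 : ∀ {g} t → δ ≡ t ℕ.* g → g < δ → t ≢ 1
      t≢1 {g} t e g<δ refl = ℕP.<⇒≢ g<δ (sym (trans e (ℕP.*-identityˡ g)))
      minimal : ∀ j → j < δ → 0 < j → ¬ PowIsOne m x j
      minimal j j<δ 0<j h with GCD.gcd[m,n]∣n j δ | ℕP.≤-<-trans (∣ℕ.∣⇒≤ {{ℕ.>-nonZero 0<j}} (GCD.gcd[m,n]∣m j δ)) j<δ
      -- With g = gcd(j, δ) < δ, the quotient t = δ / g has a prime factor r. Then g divides δ / r,
      -- one of the excluded exponents, although x^g ≡ 1.
      ... | divides t e | g<δ with prime-divisor {t} {{ℕP.m*n≢0⇒m≢0 t {{subst NonZero e δ≢0}}}} (t≢1 t e g<δ)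
      ... | r , rr , divides u refl =
        All.lookup none (∈-cofactors⁺ {u ℕ.* gcd j δ} c qs {{prime⇒nonZero rr}} (complete rr (divides (u ℕ.* gcd j δ) e′)) (sym e′))
          (One-∣ {x = x} (divides u refl) (One-gcd j δ (PowIsOne⇒One m x j h) one))
        where
        e′ : δ ≡ u ℕ.* gcd j δ ℕ.* r
        e′ = trans e (eq u r (gcd j δ))
          where
          eq : ∀ u r g → u ℕ.* r ℕ.* g ≡ u ℕ.* g ℕ.* r
          eq = ℕS.solve-∀

    indSum≡exactSum : indSum m δ ≡ exactSum c qs
    indSum≡exactSum = cong sum (LP.filter-≐ (λ a → (gcd a m ℕ.≟ 1) ×-dec isInd? m a δ) (exact? c qs)
      ((λ (_ , ind) → IsInd⇒Exact ind) ,
       -- Membership in the unit group follows from x^δ ≡ 1 with δ > 0.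
       (λ {x} ex → coprime⇒InU (One⇒coprime {x = x} δ 0<δ (proj₁ ex)) , Exact⇒IsInd ex)) (upTo m))

-- Sums over the solutions of x ^ d ≡ 1 modulo a prime power

*-^-distrib : ∀ x y n → (x ℕ.* y) ^ n ≡ x ^ n ℕ.* y ^ n
*-^-distrib x y zero    = refl
*-^-distrib x y (suc n) = trans (cong (x ℕ.* y ℕ.*_) (*-^-distrib x y n)) (eq x y (x ^ n) (y ^ n))
  where
  eq : ∀ x y a b → x ℕ.* y ℕ.* (a ℕ.* b) ≡ x ℕ.* a ℕ.* (y ℕ.* b)
  eq = ℕS.solve-∀

modulus-+-∼ : ∀ {m} x → + (m ℕ.+ x) ∼[ m ] + x
modulus-+-∼ {m} x = ∼-pos-+ {a = m} {0} {x} {x} (∣⇒∼0 ∣ℕ.∣-refl) ∼-refl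

One-pos-+ : ∀ {m x} → One m x → One m (m ℕ.+ x)
One-pos-+ {x = x} = ∼-trans (modulus-+-∼ x)

One-pos-+⁻¹ : ∀ {m x} → One m (m ℕ.+ x) → One m x
One-pos-+⁻¹ {x = x} = ∼-trans (∼-sym (modulus-+-∼ x))

powerSum : ℕ → ℕ → ℕ
powerSum m d = sum (select (λ x → one? m (x ^ d)) m)

powerSum-*-invariant : ∀ {m u d} .{{_ : NonZero m}} → 0 < d → One m (u ^ d) →
  + (u ℕ.* powerSum m d) ∼[ m ] + powerSum m d
powerSum-*-invariant {m} {u} {d} 0<d one = ∼-trans (∼-sym (sum-map-*% u (select P? m)))
  (∼-reflexive (cong +_ (sum-↭ (select-*-permutes P? (One⇒coprime {x = u} d 0<d one)
    λ {x} onex → ∼-trans (∼-pos-^ d (∼-% (u ℕ.* x))) (subst (One m) (sym (*-^-distrib u x d)) (One-* one onex))))))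
  where
  P? : Decidable (λ x → One m (x ^ d))
  P? x = one? m (x ^ d)

select-residue-one : ∀ {h} → 1 < h → select (one? h) h ≡ 1 ∷ []
select-residue-one {suc zero} (s≤s ())
select-residue-one {suc (suc n)} _ = begin
  filter (one? h) (0 ∷ 1 ∷ rest)  ≡⟨ LP.filter-reject (one? h) {xs = 1 ∷ rest} 0≁1 ⟩
  filter (one? h) (1 ∷ rest)      ≡⟨ LP.filter-accept (one? h) {xs = rest} (∼-refl {h} {+ 1}) ⟩
  1 ∷ filter (one? h) rest        ≡⟨ cong (1 ∷_) (LP.filter-none (one? h) {xs = rest} (AllP.applyUpTo⁺₁ (suc ∘ suc) n λ i<n p → ≁1 (∼⇒≡ (s≤s (s≤s i<n)) (s≤s (s≤s z≤n)) p))) ⟩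
  1 ∷ []                          ∎
  where
  open ≡-Reasoning
  h : ℕ
  h = suc (suc n)
  rest : List ℕ
  rest = applyUpTo (suc ∘ suc) n
  0≁1 : ¬ One h 0
  0≁1 p with ∼⇒≡ {h} (s≤s z≤n) (s≤s (s≤s z≤n)) p
  ... | ()
  ≁1 : ∀ {i} → suc (suc i) ≢ 1
  ≁1 ()

-- The residues in question are 1 + i h for i < n.
sum-residue-one : ∀ {h} → 1 < h → ∀ n → sum (select (one? h) (n ℕ.* h)) ≡ n ℕ.+ triangle n ℕ.* h
sum-residue-one 1<h zero = refl
sum-residue-one {h} 1<h (suc n) = begin
  sum (select (one? h) (h ℕ.+ n ℕ.* h))
    ≡⟨ sum-select-+ (one? h) One-pos-+ One-pos-+⁻¹ (n ℕ.* h) ⟩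
  sum (select (one? h) h) ℕ.+ (length (select (one? h) (n ℕ.* h)) ℕ.* h ℕ.+ sum (select (one? h) (n ℕ.* h)))
    ≡⟨ cong₂ (λ a b → sum a ℕ.+ (b ℕ.* h ℕ.+ sum (select (one? h) (n ℕ.* h)))) (select-residue-one 1<h)
         (trans (length-select-* (one? h) One-pos-+ One-pos-+⁻¹ n) (trans (cong (λ xs → n ℕ.* length xs) (select-residue-one 1<h)) (ℕP.*-identityʳ n))) ⟩
  1 ℕ.+ (n ℕ.* h ℕ.+ sum (select (one? h) (n ℕ.* h)))
    ≡⟨ cong (λ s → 1 ℕ.+ (n ℕ.* h ℕ.+ s)) (sum-residue-one 1<h n) ⟩
  1 ℕ.+ (n ℕ.* h ℕ.+ (n ℕ.+ triangle n ℕ.* h))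
    ≡⟨ eq n h (triangle n) ⟩
  suc n ℕ.+ (n ℕ.+ triangle n) ℕ.* h ∎
  where
  open ≡-Reasoning
  eq : ∀ n h t → 1 ℕ.+ (n ℕ.* h ℕ.+ (n ℕ.+ t ℕ.* h)) ≡ (1 ℕ.+ n) ℕ.+ (n ℕ.+ t) ℕ.* h
  eq = ℕS.solve-∀

module _ {p : ℕ} (pp : Prime p) where

  private instance
    p≢0 : NonZero p
    p≢0 = prime⇒nonZero pp

  1<p : 1 < p
  1<p = ℕ.nonTrivial⇒n>1 p {{prime⇒nonTrivial pp}}

  p⊥p∸1 : Coprime p (p ∸ 1)
  p⊥p∸1 = ∤⇒coprime pp λ d → ℕP.<⇒≱ (ℕP.∸-monoʳ-< {p} {1} {0} (s≤s z≤n) (ℕP.<⇒≤ 1<p))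
    (∣ℕ.∣⇒≤ {{ℕ.>-nonZero (ℕP.m<n⇒0<n∸m 1<p)}} d)

  fermat : ∀ {x} → Coprime p x → One p (x ^ (p ∸ 1))
  fermat {x} c = subst (λ n → One p (x ^ n)) φp (euler c)
    where
    φp : φ p ≡ p ∸ 1
    φp = trans (cong φ (sym (ℕP.*-identityʳ p))) (trans (φ-prime-power 0 pp) (ℕP.*-identityˡ (p ∸ 1)))

  -- The order of x divides both p ^ j and p ∸ 1.
  One-p^-root : ∀ {x} j → One p (x ^ (p ^ j)) → One p x
  One-p^-root {x} j one = subst (One p) (ℕP.*-identityʳ x)
    (subst (λ n → One p (x ^ n)) (coprime⇒gcd≡1 (coprime-^ˡ j p⊥p∸1))
      (One-gcd (p ^ j) (p ∸ 1) one (fermat (One⇒coprime {x = x} (p ^ j) (ℕP.m^n>0 p j) one))))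

  -- With h = p^(e+1) the modulus is p^j h and the solutions are 1 + i h for i < p^j. The excess of
  -- their sum over p^j is `triangle (p ^ j)` times h, a multiple of p^j h.
  powerSum-p^ : Coprime p 2 → ∀ j e → + powerSum (p ^ (j ℕ.+ suc e)) (p ^ j) ∼[ p ^ (j ℕ.+ suc e) ] + (p ^ j)
  powerSum-p^ p⊥2 j e with odd∣triangle (p ^ j) (coprime-^ˡ j p⊥2)
  ... | divides t et = ∼-trans (∼-reflexive (cong +_ eq)) (multiple (+ t) (cong (λ z → + (p ^ j) ℤ.+ z) eqt))
    where
    m h : ℕ
    m = p ^ (j ℕ.+ suc e)
    h = p ^ suc e
    m≡ : m ≡ p ^ j ℕ.* h
    m≡ = ℕP.^-distribˡ-+-* p j (suc e)
    1<h : 1 < h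
    1<h = ℕP.<-≤-trans 1<p (ℕP.m≤m*n p (p ^ e) {{ℕP.m^n≢0 p e}})
    p∣m : p ∣ m
    p∣m = subst (λ n → p ∣ p ^ n) (sym (ℕP.+-suc j e)) (∣ℕ.m∣m*n (p ^ (j ℕ.+ e)))
    eq : powerSum m (p ^ j) ≡ p ^ j ℕ.+ triangle (p ^ j) ℕ.* h
    eq = trans (cong sum (LP.filter-≐ (λ x → one? m (x ^ (p ^ j))) (one? h)
      ((λ {x} one → One-^p^⁻¹ (suc e) j pp p⊥2 (One-p^-root j (∼-divisor p∣m one)) one) , One-^p^ j) (upTo m)))
      (trans (cong (λ n → sum (select (one? h) n)) m≡) (sum-residue-one 1<h (p ^ j)))
    eqt : + (triangle (p ^ j) ℕ.* h) ≡ + t ℤ.* + m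
    eqt = trans (cong +_ (trans (cong (ℕ._* h) et) (trans (ℕP.*-assoc t (p ^ j) h) (cong (t ℕ.*_) (sym m≡))))) (ℤP.pos-* t m)

  module _ {a L : ℕ} (carmichael : IsCarmichael (p ^ suc a) L) where

    private
      m : ℕ
      m = p ^ suc a
      instance
        m≢0 : NonZero m
        m≢0 = ℕP.m^n≢0 p (suc a)
        L≢0 : NonZero L
        L≢0 = ℕ.>-nonZero (proj₁ carmichael)

    L∣φ : L ∣ p ^ a ℕ.* (p ∸ 1)
    L∣φ = subst (L ∣_) (φ-prime-power a pp) (carmichael-∣ carmichael λ _ → euler)

    -- If x ^ (L / d) ≡ 1 mod p for all units x then (L / d) p^a is an exponent, so d ∣ p^a.
    root-off-one : ∀ {d r} → d ∣ L → Prime r → r ≢ p → r ∣ d → Σ[ u ∈ ℕ ] One m (u ^ d) × ¬ One p u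
    root-off-one {d} {r} (divides q L≡qd) rr r≢p r∣d
      with ℕP.anyUpTo? (λ x → (gcd x m ℕ.≟ 1) ×-dec ¬? (one? p (x ^ q))) m
    ... | yes (x , x<m , x∈U , ¬one) = x ^ q ,
      subst (One m) (trans (cong (x ^_) L≡qd) (sym (ℕP.^-*-assoc x q d))) (PowIsOne⇒One m x L (proj₁ (proj₂ carmichael) x x<m x∈U)) , ¬one
    -- Here q p^a is an exponent of the unit group, so L = q d divides it and d divides p^a, whose
    -- only prime factor is p.
    ... | no none = contradiction (prime∣prime⇒≡ rr pp (prime∣^⇒∣ a rr (∣ℕ.∣-trans r∣d d∣p^a))) r≢p
      where
      all : ∀ {x} → x < m → Coprime m x → One m (x ^ (q ℕ.* p ^ a))
      all {x} x<m c with one? p (x ^ q)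
      ... | no ¬one = contradiction (x , x<m , coprime⇒InU c , ¬one) none
      ... | yes one = subst₂ (λ n y → One (p ^ n) y) (ℕP.+-comm a 1) (ℕP.^-*-assoc x q (p ^ a))
        (One-^p^ {e = 0} a (subst (λ n → One n (x ^ q)) (sym (ℕP.*-identityʳ p)) one))
      d∣p^a : d ∣ p ^ a
      d∣p^a = ∣ℕ.*-cancelˡ-∣ q {{ℕP.m*n≢0⇒m≢0 q {{subst NonZero L≡qd L≢0}}}} (subst (_∣ q ℕ.* p ^ a) L≡qd (carmichael-∣ carmichael all))

    powerSum-zero : ∀ {d r} → d ∣ L → Prime r → r ≢ p → r ∣ d → + powerSum m d ∼[ m ] + 0
    powerSum-zero {d} d∣L rr r≢p r∣d with root-off-one d∣L rr r≢p r∣d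
    ... | u , one , ¬one = ∼-cancelˡ {u = + u ℤ.- + 1} (coprime-^ˡ (suc a) (∤⇒coprime pp λ d → ¬one (mod⇒∼ d)))
      (∼-trans (∼-reflexive (trans (eq (+ u) G) (cong (λ z → z ℤ.- G) (sym (ℤP.pos-* u (powerSum m d))))))
        (∼-trans (∼-- {y = G} (powerSum-*-invariant {u = u} 0<d one) (∼-refl {x = G})) (∼-reflexive (eq′ (+ u) G))))
      where
      G : ℤ
      G = + powerSum m d
      0<d : 0 < d
      0<d = ℕP.n≢0⇒n>0 λ { refl → ℕP.<⇒≢ (proj₁ carmichael) (sym (∣ℕ.0∣⇒≡0 d∣L)) }
      eq : ∀ u g → (u ℤ.- + 1) ℤ.* g ≡ u ℤ.* g ℤ.- g
      eq = solve-∀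
      eq′ : ∀ u g → g ℤ.- g ≡ (u ℤ.- + 1) ℤ.* + 0
      eq′ = solve-∀

-- Odd prime powers

product-∣ : ∀ {c} qs → Unique qs → All Prime qs → (∀ {q} → q ∈ qs → q ∣ c) → product qs ∣ c
product-∣ []       _           _          _  = ∣ℕ.1∣ _
product-∣ (q ∷ qs) (q∉qs ∷ qs!) (qq ∷ qqs) ∣c with ∣c (here refl)
... | divides c′ refl = subst (_∣ c′ ℕ.* q) (ℕP.*-comm (product qs) q) (∣ℕ.*-monoˡ-∣ q (product-∣ qs qs! qqs ∣c′))
  where
  ∣c′ : ∀ {r} → r ∈ qs → r ∣ c′
  ∣c′ {r} r∈ with euclidsLemma c′ q (All.lookup qqs r∈) (∣c (there r∈))
  ... | inj₁ r∣c′ = r∣c′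
  ... | inj₂ r∣q  = contradiction (sym (prime∣prime⇒≡ (All.lookup qqs r∈) qq r∣q)) (All.lookup q∉qs r∈)

distinct-primes-coprime : ∀ {q qs} → Prime q → All Prime qs → All (q ≢_) qs → All (Coprime q) qs
distinct-primes-coprime {q} qq qqs q∉qs = All.tabulate λ {r} r∈ →
  ∤⇒coprime qq (All.lookup q∉qs r∈ ∘ prime∣prime⇒≡ qq (All.lookup qqs r∈))

-- The very list whose length defines `ω`, so the sign obtained from its length is the one in `μ` by
-- definition.
primeDivisors : ℕ → List ℕ
primeDivisors n = filter (λ p → prime? p ×-dec p ∣ℕ.∣? n) (upTo (suc n))

module _ (n : ℕ) where

  private
    P? : Decidable (λ p → Prime p × p ∣ n)
    P? p = prime? p ×-dec p ∣ℕ.∣? n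

  primeDivisors-unique : Unique (primeDivisors n)
  primeDivisors-unique = UP.filter⁺ P? (UP.upTo⁺ (suc n))

  ∈-primeDivisors⁻ : ∀ {r} → r ∈ primeDivisors n → Prime r × r ∣ n
  ∈-primeDivisors⁻ r∈ = proj₂ (∈-select⁻ P? {suc n} r∈)

  ∈-primeDivisors⁺ : .{{_ : NonZero n}} → ∀ {r} → Prime r → r ∣ n → r ∈ primeDivisors n
  ∈-primeDivisors⁺ rr r∣n = ∈-select⁺ P? (s≤s (∣ℕ.∣⇒≤ r∣n)) (rr , r∣n)

  primeDivisors-prime : All Prime (primeDivisors n)
  primeDivisors-prime = All.tabulate (proj₁ ∘ ∈-primeDivisors⁻)

  product-primeDivisors-∣ : product (primeDivisors n) ∣ n
  product-primeDivisors-∣ = product-∣ (primeDivisors n) primeDivisors-unique primeDivisors-prime (proj₂ ∘ ∈-primeDivisors⁻)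

  -- A prime dividing the cofactor of the radical also divides the radical, so its square would
  -- divide n.
  squarefree⇒≡product : .{{_ : NonZero n}} → SquareFree n → n ≡ product (primeDivisors n)
  squarefree⇒≡product sf with product-primeDivisors-∣
  ... | divides e n≡ with e ℕ.≟ 1
  ... | yes refl = trans n≡ (ℕP.*-identityˡ _)
  ... | no e≢1 with prime-divisor {e} {{ℕP.m*n≢0⇒m≢0 e {{subst NonZero n≡ it}}}} e≢1
  ... | r , rr , r∣e = contradiction (subst (r ℕ.* r ∣_) (sym n≡) (∣ℕ.*-pres-∣ r∣e (∈⇒∣product (∈-primeDivisors⁺ rr r∣n))))
                                     (sf r (s≤s (∣ℕ.∣⇒≤ r∣n)) rr)
    where
    r∣n : r ∣ n
    r∣n = subst (r ∣_) (sym n≡) (∣ℕ.∣m⇒∣m*n _ r∣e)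

  -- Every prime of n = f r r already divides f r, hence so does the radical, and the second r is
  -- left for the cofactor.
  square-divisor : ∀ {r} → Prime r → r ℕ.* r ∣ n → ∃ λ e → n ≡ e ℕ.* product (primeDivisors n) × r ∣ e
  square-divisor {r} rr (divides f n≡) with product-∣ {f ℕ.* r} (primeDivisors n) primeDivisors-unique primeDivisors-prime ∣fr
    where
    n≡frr : n ≡ f ℕ.* r ℕ.* r
    n≡frr = trans n≡ (sym (ℕP.*-assoc f r r))
    ∣fr : ∀ {q} → q ∈ primeDivisors n → q ∣ f ℕ.* r
    ∣fr {q} q∈ with euclidsLemma (f ℕ.* r) r (proj₁ (∈-primeDivisors⁻ q∈)) (subst (q ∣_) n≡frr (proj₂ (∈-primeDivisors⁻ q∈)))
    ... | inj₁ q∣fr = q∣fr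
    ... | inj₂ q∣r  = ∣ℕ.∣n⇒∣m*n f q∣r
  ... | divides g fr≡ = g ℕ.* r , trans n≡ (trans (sym (ℕP.*-assoc f r r)) (trans (cong (ℕ._* r) fr≡) (eq g (product (primeDivisors n)) r))) , ∣ℕ.n∣m*n g
    where
    eq : ∀ g P r → g ℕ.* P ℕ.* r ≡ g ℕ.* r ℕ.* P
    eq = ℕS.solve-∀

-1^ : ℕ → ℤ
-1^ n = (- (+ 1)) ℤ.^ n

¬squarefree⇒square : ∀ n → ¬ SquareFree n → ∃ λ r → Prime r × r ℕ.* r ∣ n
¬squarefree⇒square n ¬sf with ℕP.anyUpTo? (λ r → prime? r ×-dec (r ℕ.* r) ∣ℕ.∣? n) (suc n)
... | yes (r , _ , rr , rr∣n) = r , rr , rr∣n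
... | no none = contradiction (λ r r<1+n rr rr∣n → none (r , r<1+n , rr , rr∣n)) ¬sf

-- Evaluation of the sums over elements of order δ

module _ {p a L : ℕ} (pp : Prime p) (p⊥2 : Coprime p 2) (carmichael : IsCarmichael (p ^ suc a) L) where

  private
    m : ℕ
    m = p ^ suc a
    instance
      p≢0 : NonZero p
      p≢0 = prime⇒nonZero pp

  exactSum-difference : ∀ {c q qs x y} → All (Coprime q) qs →
    + exactSum m (c ℕ.* q) qs ∼[ m ] x → + exactSum m c qs ∼[ m ] y → + exactSum m c (q ∷ qs) ∼[ m ] x ℤ.- y
  exactSum-difference {c} {q} {qs} q⊥qs p₁ p₂ = ∼-trans
    (∼-reflexive (trans (eq (+ exactSum m c (q ∷ qs)) (+ exactSum m c qs))
                        (cong (λ n → + n ℤ.- + exactSum m c qs) (sym (exactSum-∷ m q⊥qs)))))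
    (∼-- p₁ p₂)
    where
    eq : ∀ a b → a ≡ a ℤ.+ b ℤ.- b
    eq = solve-∀

  -- The recursion only enlarges the cofactor, so r divides the exponent at every leaf, where
  -- `powerSum-zero` applies.
  exactSum-zero : ∀ {c r} qs → Unique qs → All Prime qs → c ℕ.* product qs ∣ L →
    Prime r → r ≢ p → r ∣ c → + exactSum m c qs ∼[ m ] + 0
  exactSum-zero {c} [] _ _ c∣L rr r≢p r∣c = ∼-trans (∼-reflexive (cong +_ (exactSum-[] m c)))
    (powerSum-zero pp {a} carmichael (subst (_∣ L) (ℕP.*-identityʳ c) c∣L) rr r≢p r∣c)
  exactSum-zero {c} (q ∷ qs) (q∉qs ∷ qs!) (qq ∷ qqs) cΠ∣L rr r≢p r∣c =
    exactSum-difference (distinct-primes-coprime qq qqs q∉qs)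
      (exactSum-zero qs qs! qqs (subst (_∣ L) (sym (ℕP.*-assoc c q (product qs))) cΠ∣L) rr r≢p (∣ℕ.∣m⇒∣m*n q r∣c))
      (exactSum-zero qs qs! qqs (∣ℕ.∣-trans (∣ℕ.*-monoʳ-∣ c (∣ℕ.n∣m*n q)) cΠ∣L) rr r≢p r∣c)

  p^∣L⇒≤ : ∀ {j} → p ^ j ∣ L → j ≤ a
  p^∣L⇒≤ {j} d = ℕP.≮⇒≥ λ a<j → ℕP.<⇒≱ (ℕP.^-monoʳ-< p (1<p pp) a<j)
    (∣ℕ.∣⇒≤ {{ℕP.m^n≢0 p a}} (coprime-divisor (coprime-^ˡ j (p⊥p∸1 pp))
      (subst (p ^ j ∣_) (ℕP.*-comm (p ^ a) (p ∸ 1)) (∣ℕ.∣-trans d (L∣φ pp {a} carmichael)))))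

  -- For each q, the term with q in the cofactor vanishes by `exactSum-zero`; the other is
  -- subtracted, which contributes one sign.
  exactSum-p^ : ∀ {j} qs → Unique qs → All Prime qs → All (_≢ p) qs → p ^ j ℕ.* product qs ∣ L →
    + exactSum m (p ^ j) qs ∼[ m ] -1^ (length qs) ℤ.* + (p ^ j)
  exactSum-p^ {j} [] _ _ _ d = ∼-trans (∼-reflexive (cong +_ (exactSum-[] m (p ^ j))))
    (∼-trans (subst (λ n → + powerSum (p ^ n) (p ^ j) ∼[ p ^ n ] + (p ^ j)) j+ (powerSum-p^ pp p⊥2 j (a ∸ j)))
             (∼-reflexive (sym (ℤP.*-identityˡ _))))
    where
    -- The truncated subtraction is exact: p^j divides L, hence p^a (p - 1), so j ≤ a.
    j+ : j ℕ.+ suc (a ∸ j) ≡ suc a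
    j+ = trans (ℕP.+-suc j (a ∸ j)) (cong suc (ℕP.m+[n∸m]≡n (p^∣L⇒≤ {j} (subst (_∣ L) (ℕP.*-identityʳ (p ^ j)) d))))
  exactSum-p^ {j} (q ∷ qs) (q∉qs ∷ qs!) (qq ∷ qqs) (q≢p ∷ qs≢p) d = ∼-trans
    (exactSum-difference (distinct-primes-coprime qq qqs q∉qs)
      (exactSum-zero qs qs! qqs (subst (_∣ L) (sym (ℕP.*-assoc (p ^ j) q (product qs))) d) qq q≢p (∣ℕ.n∣m*n (p ^ j)))
      (exactSum-p^ {j} qs qs! qqs qs≢p (∣ℕ.∣-trans (∣ℕ.*-monoʳ-∣ (p ^ j) (∣ℕ.n∣m*n q)) d)))
    (∼-reflexive (eq (-1^ (length qs)) (+ (p ^ j))))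
    where
    eq : ∀ s P → + 0 ℤ.- s ℤ.* P ≡ - (+ 1) ℤ.* s ℤ.* P
    eq = solve-∀

  module _ {c : ℕ} .{{_ : NonZero c}} (p∤c : p ∤ c) where

    private
      qs : List ℕ
      qs = primeDivisors c
      qs≢p : All (_≢ p) qs
      qs≢p = All.tabulate λ { r∈ refl → p∤c (proj₂ (∈-primeDivisors⁻ c r∈)) }
      p≢qs : All (p ≢_) qs
      p≢qs = All.map (_∘ sym) qs≢p
      p⊥qs : All (Coprime p) qs
      p⊥qs = distinct-primes-coprime pp (primeDivisors-prime c) p≢qs

    prime∣p^k*c : ∀ {r} k → Prime r → r ∣ p ^ k ℕ.* c → r ≡ p ⊎ r ∈ qs
    prime∣p^k*c k rr r∣ with euclidsLemma (p ^ k) c rr r∣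
    ... | inj₁ r∣p^k = inj₁ (prime∣prime⇒≡ rr pp (prime∣^⇒∣ k rr r∣p^k))
    ... | inj₂ r∣c   = inj₂ (∈-primeDivisors⁺ c rr r∣c)

    0<p^k*c : ∀ k → 0 < p ^ k ℕ.* c
    0<p^k*c k = ℕ.>-nonZero⁻¹ (p ^ k ℕ.* c) {{ℕP.m*n≢0 (p ^ k) c {{ℕP.m^n≢0 p k}}}}

    indSum-∤ : ∀ e → c ≡ e ℕ.* product qs → indSum m c ≡ exactSum m e qs
    indSum-∤ e c≡ = trans (cong (indSum m) c≡) (indSum≡exactSum m {e} {qs}
      (subst (0 <_) c≡ (ℕ.>-nonZero⁻¹ c)) (primeDivisors-prime c)
      (λ rr r∣ → ∈-primeDivisors⁺ c rr (subst (_ ∣_) (sym c≡) r∣)))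

    p^suc-factor : ∀ k e → c ≡ e ℕ.* product qs → p ^ suc k ℕ.* c ≡ p ^ k ℕ.* e ℕ.* product (p ∷ qs)
    p^suc-factor k e c≡ = trans (cong (p ^ suc k ℕ.*_) c≡) (eq p (p ^ k) e (product qs))
      where
      eq : ∀ p P e Π → p ℕ.* P ℕ.* (e ℕ.* Π) ≡ P ℕ.* e ℕ.* (p ℕ.* Π)
      eq = ℕS.solve-∀

    -- One factor p moves into the list of primes. It stands at the head, so that the outermost
    -- difference compares p^(k+1) with p^k.
    indSum-p^suc : ∀ k e → c ≡ e ℕ.* product qs → indSum m (p ^ suc k ℕ.* c) ≡ exactSum m (p ^ k ℕ.* e) (p ∷ qs)
    indSum-p^suc k e c≡ = trans (cong (indSum m) δ≡) (indSum≡exactSum m {p ^ k ℕ.* e} {p ∷ qs}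
      (subst (0 <_) δ≡ (0<p^k*c (suc k))) (pp ∷ primeDivisors-prime c)
      (λ {r} rr r∣ → here-or-there (prime∣p^k*c (suc k) rr (subst (r ∣_) (sym δ≡) r∣))))
      where
      δ≡ : p ^ suc k ℕ.* c ≡ p ^ k ℕ.* e ℕ.* product (p ∷ qs)
      δ≡ = p^suc-factor k e c≡
      here-or-there : ∀ {r} → r ≡ p ⊎ r ∈ qs → r ∈ p ∷ qs
      here-or-there (inj₁ e) = here e
      here-or-there (inj₂ e) = there e

    -- A prime whose square divides c survives in the quotient e of c by its radical, hence in every
    -- exponent of the alternating sum.
    indSum-not-squarefree : ∀ k → p ^ k ℕ.* c ∣ L → ¬ SquareFree c → + indSum m (p ^ k ℕ.* c) ∼[ m ] + 0
    indSum-not-squarefree k δ∣L ¬sf with ¬squarefree⇒square c ¬sf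
    ... | r , rr , rr∣c with square-divisor c rr rr∣c
    ... | e , c≡ , r∣e = go k δ∣L
      where
      r≢p : r ≢ p
      r≢p refl = p∤c (∣ℕ.∣-trans (∣ℕ.m∣m*n r) rr∣c)
      go : ∀ k → p ^ k ℕ.* c ∣ L → + indSum m (p ^ k ℕ.* c) ∼[ m ] + 0
      go zero    δ∣L = ∼-trans (∼-reflexive (cong +_ (trans (cong (indSum m) (ℕP.*-identityˡ c)) (indSum-∤ e c≡))))
        (exactSum-zero qs (primeDivisors-unique c) (primeDivisors-prime c) (subst (_∣ L) (trans (ℕP.*-identityˡ c) c≡) δ∣L) rr r≢p r∣e)
      go (suc k) δ∣L = ∼-trans (∼-reflexive (cong +_ (indSum-p^suc k e c≡)))
        (exactSum-zero (p ∷ qs) (p≢qs ∷ primeDivisors-unique c) (pp ∷ primeDivisors-prime c)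
          (subst (_∣ L) (p^suc-factor k e c≡) δ∣L) rr r≢p (∣ℕ.∣n⇒∣m*n (p ^ k) r∣e))

    -- The cofactor is a pure power of p. For k = 0 a single term remains, and φ(1) evaluates to 1;
    -- otherwise the head prime p leaves p^(k+1) - p^k = φ(p^(k+1)).
    indSum-squarefree : ∀ k → p ^ k ℕ.* c ∣ L → SquareFree c →
      + indSum m (p ^ k ℕ.* c) ∼[ m ] -1^ (ω c) ℤ.* + φ (p ^ k)
    indSum-squarefree zero δ∣L sf = ∼-trans
      (∼-reflexive (cong +_ (trans (cong (indSum m) (ℕP.*-identityˡ c)) (indSum-∤ 1 c≡))))
      (exactSum-p^ {0} qs (primeDivisors-unique c) (primeDivisors-prime c) qs≢p (subst (_∣ L) (trans (ℕP.*-identityˡ c) c≡) δ∣L))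
      where
      c≡ : c ≡ 1 ℕ.* product qs
      c≡ = trans (squarefree⇒≡product c sf) (sym (ℕP.*-identityˡ (product qs)))
    indSum-squarefree (suc k) δ∣L sf = ∼-trans
      (∼-reflexive (cong +_ (trans (indSum-p^suc k 1 c≡) (cong (λ n → exactSum m n (p ∷ qs)) (ℕP.*-identityʳ (p ^ k))))))
      (∼-trans (exactSum-difference p⊥qs
          (subst (λ n → + exactSum m n qs ∼[ m ] -1^ (ω c) ℤ.* + (p ^ suc k)) (ℕP.*-comm p (p ^ k))
            (exactSum-p^ {suc k} qs (primeDivisors-unique c) (primeDivisors-prime c) qs≢p δ∣L′))
          (exactSum-p^ {k} qs (primeDivisors-unique c) (primeDivisors-prime c) qs≢p
            (∣ℕ.∣-trans (∣ℕ.*-monoˡ-∣ (product qs) (∣ℕ.n∣m*n p)) δ∣L′)))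
        (∼-reflexive (trans (eq (-1^ (ω c)) (+ (p ^ suc k)) (+ (p ^ k))) (cong (-1^ (ω c) ℤ.*_) φ≡))))
      where
      c≡′ : c ≡ product qs
      c≡′ = squarefree⇒≡product c sf
      c≡ : c ≡ 1 ℕ.* product qs
      c≡ = trans c≡′ (sym (ℕP.*-identityˡ (product qs)))
      δ∣L′ : p ^ suc k ℕ.* product qs ∣ L
      δ∣L′ = subst (λ n → p ^ suc k ℕ.* n ∣ L) c≡′ δ∣L
      eq : ∀ s a b → s ℤ.* a ℤ.- s ℤ.* b ≡ s ℤ.* (a ℤ.- b)
      eq = solve-∀
      φ≡ : + (p ^ suc k) ℤ.- + (p ^ k) ≡ + φ (p ^ suc k)
      φ≡ = begin
        + (p ^ suc k) ℤ.- + (p ^ k)              ≡⟨ cong (λ n → + (n ℕ.* p ^ k) ℤ.- + (p ^ k)) (sym (ℕP.m+[n∸m]≡n (ℕP.<⇒≤ (1<p pp)))) ⟩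
        + (p ^ k ℕ.+ (p ∸ 1) ℕ.* p ^ k) ℤ.- + (p ^ k) ≡⟨ eq′ (+ (p ^ k)) (+ ((p ∸ 1) ℕ.* p ^ k)) ⟩
        + ((p ∸ 1) ℕ.* p ^ k)                    ≡⟨ cong +_ (trans (ℕP.*-comm (p ∸ 1) (p ^ k)) (sym (φ-prime-power k pp))) ⟩
        + φ (p ^ suc k)                          ∎
        where
        open ≡-Reasoning
        eq′ : ∀ a b → (a ℤ.+ b) ℤ.- a ≡ b
        eq′ = solve-∀

    indSum-prime-power : ∀ k → p ^ k ℕ.* c ∣ L → + indSum m (p ^ k ℕ.* c) ∼[ m ] μ c ℤ.* + φ (p ^ k)
    indSum-prime-power k δ∣L with squareFree? c
    ... | yes sf = indSum-squarefree k δ∣L sf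
    ... | no ¬sf = ∼-trans (indSum-not-squarefree k δ∣L ¬sf) (∼-reflexive (sym (ℤP.*-zeroˡ (+ φ (p ^ k)))))

  -- The gcd divides p - 1, so it is prime to p and divides c. Conversely c is prime to p and
  -- divides L, hence p^a (p - 1), hence p - 1.
  gcd-p∸1 : ∀ {c} k → p ∤ c → p ^ k ℕ.* c ∣ L → gcd (p ^ k ℕ.* c) (p ∸ 1) ≡ c
  gcd-p∸1 {c} k p∤c δ∣L = ∣ℕ.∣-antisym
    (coprime-divisor (Coprimality.sym (coprime-^ˡ k (∤⇒coprime pp λ p∣g → p∤1 pp
        (subst (p ∣_) (p⊥p∸1 pp (∣ℕ.∣-refl , ∣ℕ.∣-trans p∣g (GCD.gcd[m,n]∣n δ (p ∸ 1)))) ∣ℕ.∣-refl))))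
      (GCD.gcd[m,n]∣m δ (p ∸ 1)))
    (GCD.gcd-greatest (∣ℕ.n∣m*n (p ^ k))
      (coprime-divisor (Coprimality.sym (coprime-^ˡ a (∤⇒coprime pp p∤c)))
        (∣ℕ.∣-trans (∣ℕ.∣-trans (∣ℕ.n∣m*n (p ^ k)) δ∣L) (L∣φ pp {a} carmichael))))
    where
    δ : ℕ
    δ = p ^ k ℕ.* c

odd-prime-power : ∀ p α L δ k → Prime p → p ≢ 2 → 0 < α → IsCarmichael (p ^ α) L → 0 < δ → δ ∣ L →
  p ^ k ∣ δ → ¬ (p ^ suc k ∣ δ) → + indSum (p ^ α) δ ≡ μ (gcd δ (p ∸ 1)) ℤ.* + φ (p ^ k) [mod p ^ α ]
odd-prime-power p (suc a) L δ k pp p≢2 _ carmichael 0<δ δ∣L (divides c δ≡c*p^k) p^∤δ =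
  ∼⇒mod (subst (λ n → + indSum (p ^ suc a) n ∼[ p ^ suc a ] μ (gcd n (p ∸ 1)) ℤ.* + φ (p ^ k)) (sym δ≡)
    (subst (λ n → + indSum (p ^ suc a) (p ^ k ℕ.* c) ∼[ p ^ suc a ] μ n ℤ.* + φ (p ^ k)) (sym (gcd-p∸1 {a = a} pp p⊥2 carmichael k p∤c p^k*c∣L))
      (indSum-prime-power {a = a} pp p⊥2 carmichael {{c≢0}} p∤c k p^k*c∣L)))
  where
  δ≡ : δ ≡ p ^ k ℕ.* c
  δ≡ = trans δ≡c*p^k (ℕP.*-comm c (p ^ k))
  p^k*c∣L : p ^ k ℕ.* c ∣ L
  p^k*c∣L = subst (_∣ L) δ≡ δ∣L
  c≢0 : NonZero c
  c≢0 = ℕP.m*n≢0⇒m≢0 c {{subst NonZero δ≡c*p^k (ℕ.>-nonZero 0<δ)}}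
  p∤c : p ∤ c
  p∤c p∣c = p^∤δ (subst (p ^ suc k ∣_) (sym δ≡c*p^k) (∣ℕ.*-monoˡ-∣ (p ^ k) p∣c))
  p⊥2 : Coprime p 2
  p⊥2 = ∤⇒coprime pp (p≢2 ∘ prime∣prime⇒≡ pp prime[2])

-- Powers of two

sum-map-∸ : ∀ {h xs} → All (_≤ h) xs → sum (map (h ∸_) xs) ℕ.+ sum xs ≡ length xs ℕ.* h
sum-map-∸ [] = refl
sum-map-∸ {h} {x ∷ xs} (x≤h ∷ xs≤h) = trans (eq (h ∸ x) (sum (map (h ∸_) xs)) x (sum xs))
  (cong₂ ℕ._+_ (ℕP.m∸n+n≡m x≤h) (sum-map-∸ xs≤h))
  where
  eq : ∀ a b c d → a ℕ.+ b ℕ.+ (c ℕ.+ d) ≡ a ℕ.+ c ℕ.+ (b ℕ.+ d)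
  eq = ℕS.solve-∀

^-even : ∀ x n → x ^ (2 ℕ.* n) ≡ (x ℕ.* x) ^ n
^-even x n = trans (sym (ℕP.^-*-assoc x 2 n)) (cong (λ y → (x ℕ.* y) ^ n) (ℕP.*-identityʳ x))

One-^-even : ∀ {m x y} n → + (x ℕ.* x) ∼[ m ] + (y ℕ.* y) → One m (x ^ (2 ℕ.* n)) → One m (y ^ (2 ℕ.* n))
One-^-even {m} {x} {y} n x²∼y² one = subst (One m) (sym (^-even y n))
  (∼-trans (∼-sym (∼-pos-^ n x²∼y²)) (subst (One m) (^-even x n) one))

-- With h = m / 2 even, h + x and h - x have the same square as x modulo m, hence the same order if
-- that is a multiple of 4: the solutions x < h are symmetric about h / 2, and x ↦ h + x gives the others.
module _ (g b : ℕ) (0<g : 0 < g) where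

  private
    h m : ℕ
    h = 2 ℕ.* g
    m = h ℕ.+ h
    P : ℕ → Set
    P = Exact m (2 ^ suc b) (2 ∷ [])
    P? : Decidable P
    P? = exact? m (2 ^ suc b) (2 ∷ [])

  -- Both exponents in `P`, namely 2^(b+2) and 2^(b+1), are even, so `P` depends only on the square
  -- of x.
  Exact-square : ∀ {x y} → + (x ℕ.* x) ∼[ m ] + (y ℕ.* y) → P x → P y
  Exact-square {x} {y} x²∼y² (one , ¬one ∷ []) =
    subst (λ n → One m (y ^ n)) (sym eq) (One-^-even {x = x} {y} (2 ^ suc b) x²∼y² (subst (λ n → One m (x ^ n)) eq one)) ,
    (λ one′ → ¬one (subst (λ n → One m (x ^ n)) (sym eq′)
      (One-^-even {x = y} {x} (2 ^ b) (∼-sym x²∼y²) (subst (λ n → One m (y ^ n)) eq′ one′)))) ∷ []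
    where
    eq : 2 ^ suc b ℕ.* 2 ≡ 2 ℕ.* 2 ^ suc b
    eq = ℕP.*-comm (2 ^ suc b) 2
    eq′ : 2 ^ suc b ℕ.* 1 ≡ 2 ℕ.* 2 ^ b
    eq′ = ℕP.*-identityʳ (2 ^ suc b)

  -- Since h = 2 g and m = 4 g, h² + 2 h x = (g + x) m; likewise (h - x)² = x² + (g - x) m, where g
  -- - x may be negative.
  square-shift : ∀ x → + ((h ℕ.+ x) ℕ.* (h ℕ.+ x)) ∼[ m ] + (x ℕ.* x)
  square-shift x = multiple (+ (g ℕ.+ x)) (trans (cong +_ (eq g x))
    (cong (λ z → + (x ℕ.* x) ℤ.+ z) (ℤP.pos-* (g ℕ.+ x) m)))
    where
    eq : ∀ g x → (2 ℕ.* g ℕ.+ x) ℕ.* (2 ℕ.* g ℕ.+ x) ≡ x ℕ.* x ℕ.+ (g ℕ.+ x) ℕ.* (2 ℕ.* g ℕ.+ 2 ℕ.* g)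
    eq = ℕS.solve-∀

  square-reflect : ∀ {x y} → y ℕ.+ x ≡ h → + (x ℕ.* x) ∼[ m ] + (y ℕ.* y)
  square-reflect {x} {y} y+x≡h = ∼-sym (multiple (+ g ℤ.- + x)
    (subst₂ _≡_ (sym (ℤP.pos-* y y)) (cong₂ (λ u v → u ℤ.+ (+ g ℤ.- + x) ℤ.* v) (sym (ℤP.pos-* x x)) (sym m≡))
      (subst (λ z → z ℤ.* z ≡ + x ℤ.* + x ℤ.+ (+ g ℤ.- + x) ℤ.* (+ 4 ℤ.* + g)) (sym y≡) (eq (+ g) (+ x)))))
    where
    eq : ∀ g x → (+ 2 ℤ.* g ℤ.- x) ℤ.* (+ 2 ℤ.* g ℤ.- x) ≡ x ℤ.* x ℤ.+ (g ℤ.- x) ℤ.* (+ 4 ℤ.* g)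
    eq = solve-∀
    eq′ : ∀ a b → a ≡ (a ℤ.+ b) ℤ.- b
    eq′ = solve-∀
    y≡ : + y ≡ + 2 ℤ.* + g ℤ.- + x
    y≡ = trans (eq′ (+ y) (+ x)) (cong (λ z → z ℤ.- + x) (trans (cong +_ y+x≡h) (ℤP.pos-* 2 g)))
    eq″ : ∀ g → 2 ℕ.* g ℕ.+ 2 ℕ.* g ≡ 4 ℕ.* g
    eq″ = ℕS.solve-∀
    m≡ : + m ≡ + 4 ℤ.* + g
    m≡ = trans (cong +_ (eq″ g)) (ℤP.pos-* 4 g)

  private
    δ≡ : 2 ^ suc (suc b) ≡ 2 ^ suc b ℕ.* 2
    δ≡ = ℕP.*-comm 2 (2 ^ suc b)
    0<δ : 0 < 2 ^ suc b ℕ.* 2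
    0<δ = subst (0 <_) δ≡ (ℕP.m^n>0 2 (suc (suc b)))

  -- Keeps the reflection inside the range: h ∸ x < h requires x > 0.
  Exact⇒≢0 : ∀ {x} → P x → x ≢ 0
  Exact⇒≢0 (one , _) refl = ℕP.<⇒≱ (ℕP.+-mono-≤ 0<h 0<h) (ℕP.≤-reflexive m≡1)
    where
    0<h : 0 < h
    0<h = ℕP.<-≤-trans 0<g (ℕP.m≤n*m g 2)
    m≡1 : m ≡ 1
    m≡1 = One⇒coprime {m} {0} (2 ^ suc b ℕ.* 2) 0<δ one (∣ℕ.∣-refl , m ∣ℕ.∣0)

  reflect-permutes : map (h ∸_) (select P? h) ↭ select P? h
  reflect-permutes = select-permutes P? (h ∸_)
    (λ {x} x<h px → ℕP.∸-monoʳ-< (ℕP.n≢0⇒n>0 (Exact⇒≢0 px)) (ℕP.<⇒≤ x<h) ,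
                    Exact-square (square-reflect {x} {h ∸ x} (ℕP.m∸n+n≡m (ℕP.<⇒≤ x<h))) px)
    (λ x<h y<h _ _ e → ℕP.∸-cancelˡ-≡ (ℕP.<⇒≤ x<h) (ℕP.<⇒≤ y<h) e)

  -- Let n solutions lie below h, with sum S. Reflection gives 2 S = n h, and the upper half
  -- contributes n h + S, so the total is n h + n h = n m.
  indSum-4∣ : m ∣ indSum m (2 ^ suc (suc b))
  indSum-4∣ = divides (length xs) (begin
    indSum m (2 ^ suc (suc b))        ≡⟨ cong (indSum m) δ≡ ⟩
    indSum m (2 ^ suc b ℕ.* 2)        ≡⟨ indSum≡exactSum m {2 ^ suc b} {2 ∷ []} 0<δ (prime[2] ∷ []) complete ⟩
    sum (select P? (h ℕ.+ h))         ≡⟨ sum-select-+ P? {h} (λ {x} → Exact-square (∼-sym (square-shift x))) (λ {x} → Exact-square (square-shift x)) h ⟩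
    S ℕ.+ (length xs ℕ.* h ℕ.+ S)     ≡⟨ eq S (length xs ℕ.* h) ⟩
    S ℕ.+ S ℕ.+ length xs ℕ.* h       ≡⟨ cong (ℕ._+ length xs ℕ.* h) 2S ⟩
    length xs ℕ.* h ℕ.+ length xs ℕ.* h ≡⟨ ℕP.*-distribˡ-+ (length xs) h h ⟨
    length xs ℕ.* m                   ∎)
    where
    open ≡-Reasoning
    xs : List ℕ
    xs = select P? h
    S : ℕ
    S = sum xs
    complete : ∀ {r} → Prime r → r ∣ 2 ^ suc b ℕ.* 2 → r ∈ 2 ∷ []
    complete {r} rr r∣ = here (prime∣prime⇒≡ rr prime[2] (prime∣^⇒∣ (suc (suc b)) rr (subst (r ∣_) (sym δ≡) r∣)))
    eq : ∀ s l → s ℕ.+ (l ℕ.+ s) ≡ s ℕ.+ s ℕ.+ l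
    eq = ℕS.solve-∀
    2S : S ℕ.+ S ≡ length xs ℕ.* h
    2S = trans (cong (ℕ._+ S) (sym (sum-↭ reflect-permutes)))
      (sum-map-∸ (All.tabulate (ℕP.<⇒≤ ∘ proj₁ ∘ ∈-select⁻ P? {h})))

power-of-two : ∀ α β → 3 < α → 1 < β → + indSum (2 ^ α) (2 ^ β) ≡ + 0 [mod 2 ^ α ]
power-of-two (suc (suc a)) (suc (suc b)) _ _ = ∼⇒mod (∣⇒∼0 (subst (λ n → n ∣ indSum n (2 ^ suc (suc b)))
  -- 2^(a+2) unfolds to h + (h + 0) with h = 2 * 2^a, hence g = 2^a.
  (cong (2 ^ suc a ℕ.+_) (sym (ℕP.+-identityʳ (2 ^ suc a)))) (indSum-4∣ (2 ^ a) b (ℕP.m^n>0 2 a))))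
power-of-two (suc zero) _ (s≤s ()) _
power-of-two _ (suc zero) _ (s≤s ())

-- The moduli 2, 4 and 8

carmichael-≤ : ∀ {m L δ} n .{{_ : NonZero n}} → IsCarmichael m L → δ ∣ L → (∀ {a} → a < m → InU m a → PowIsOne m a n) → δ ≤ n
carmichael-≤ {m} n carmichael δ∣L all = ∣ℕ.∣⇒≤ (∣ℕ.∣-trans δ∣L
  (carmichael-∣ carmichael λ {a} a<m c → PowIsOne⇒One m a n (all a<m (coprime⇒InU c))))

allPowIsOne? : ∀ m n → Dec (∀ {a} → a < m → InU m a → PowIsOne m a n)
allPowIsOne? m n = ℕP.allUpTo? (λ a → (gcd a m ℕ.≟ 1) →-dec ((+ (a ^ n)) ≡? + 1 [mod m ])) m

-- An exponent of the unit group, checked by evaluation, bounds δ: by 1 for the modulus 2, by 2 for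
-- the moduli 4 and 8. The remaining values of δ are decided by computation.
modulus-2 : ∀ L δ → IsCarmichael 2 L → 0 < δ → δ ∣ L → + indSum 2 δ ≡ + 1 [mod 2 ]
modulus-2 L δ carmichael 0<δ δ∣L with δ | 0<δ | carmichael-≤ 1 carmichael δ∣L (from-yes (allPowIsOne? 2 1))
... | 1 | _ | _ = from-yes ((+ indSum 2 1) ≡? + 1 [mod 2 ])
... | suc (suc _) | _ | s≤s ()

modulus-4 : ∀ L δ → IsCarmichael 4 L → 0 < δ → δ ∣ L → + indSum 4 δ ≡ -1^ (suc δ) [mod 4 ]
modulus-4 L δ carmichael 0<δ δ∣L with δ | 0<δ | carmichael-≤ 2 carmichael δ∣L (from-yes (allPowIsOne? 4 2))
... | 1 | _ | _ = from-yes ((+ indSum 4 1) ≡? -1^ 2 [mod 4 ])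
... | 2 | _ | _ = from-yes ((+ indSum 4 2) ≡? -1^ 3 [mod 4 ])
... | suc (suc (suc _)) | _ | s≤s (s≤s ())

modulus-8 : ∀ L δ → IsCarmichael 8 L → 0 < δ → δ ∣ L → + indSum 8 δ ≡ -1^ (suc δ) [mod 8 ]
modulus-8 L δ carmichael 0<δ δ∣L with δ | 0<δ | carmichael-≤ 2 carmichael δ∣L (from-yes (allPowIsOne? 8 2))
... | 1 | _ | _ = from-yes ((+ indSum 8 1) ≡? -1^ 2 [mod 8 ])
... | 2 | _ | _ = from-yes ((+ indSum 8 2) ≡? -1^ 3 [mod 8 ])
... | suc (suc (suc _)) | _ | s≤s (s≤s ())

theorem1p8 : (∀ L δ → IsCarmichael 2 L → 0 < δ → δ ∣ L →
    + indSum 2 δ ≡ + 1 [mod 2 ])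
    ×
    (∀ L δ → IsCarmichael 4 L → 0 < δ → δ ∣ L →
    + indSum 4 δ ≡ (- (+ 1)) ℤ.^ suc δ [mod 4 ])
    ×
    (∀ L δ → IsCarmichael 8 L → 0 < δ → δ ∣ L →
    + indSum 8 δ ≡ (- (+ 1)) ℤ.^ suc δ [mod 8 ])
    ×
    (∀ α β → 3 < α → 1 < β → β ≤ α ∸ 2 →
    + indSum (2 ^ α) (2 ^ β) ≡ + 0 [mod 2 ^ α ])
    ×
    (∀ p α L δ k → Prime p → p ≢ 2 → 0 < α →
    IsCarmichael (p ^ α) L → 0 < δ → δ ∣ L →
    p ^ k ∣ δ → ¬ (p ^ suc k ∣ δ) →
    + indSum (p ^ α) δ ≡ μ (gcd δ (p ∸ 1)) ℤ.* + φ (p ^ k) [mod p ^ α ])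
theorem1p8 = modulus-2 , modulus-4 , modulus-8 , (λ α β 3<α 1<β _ → power-of-two α β 3<α 1<β) , odd-prime-power
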